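{- Let $\beta\ge1$, let $\alpha\in\mathbb{R}\setminus\mathbb{Q}$, and let $\frac pq\in\mathbb{Q}$ with $p\in\mathbb{Z}$, $q\in\mathbb{N}$, $\gcd(p,q)=1$. Let $(q_n)_n$ be the sequence of denominators of the convergents of $\alpha$. Then $$\mu_+\left(\alpha,\beta,\frac pq\right)=0\quad\left(\text{resp. }\mu_-\left(\alpha,\beta,\frac pq\right)=0\right)$$ if and only if $$\liminf_{n\to+\infty,\ q\mid q_{2n}}q_{2n}^{\beta}\cdot\{q_{2n}\alpha\}_2=0\quad\left(\text{resp. }\liminf_{n\to+\infty,\ q\mid q_{2n-1}}-q_{2n-1}^{\beta}\cdot\{q_{2n-1}\alpha\}_2=0\right).$$
   Context: For $x\in\mathbb{R}$, $\{x\}_2$ is the signed fractional part, the unique number in $[-\frac12,\frac12)$ with $x-\{x\}_2\in\mathbb{Z}$. For $\alpha\in\mathbb{R}\setminus\mathbb{Q}$, $\beta>0$, $\rho\in\mathbb{R}$ set $$\mu_+(\alpha,\beta,\rho)=\liminf_{k\to+\infty,\ \{k\alpha-\rho\}_2>0}k^\beta\{k\alpha-\rho\}_2,\qquad \mu_-(\alpha,\beta,\rho)=\liminf_{k\to+\infty,\ \{k\alpha-\rho\}_2<0}-k^\beta\{k\alpha-\rho\}_2 ,$$ with $k$ ranging over $\mathbb{N}=\{1,2,\dots\}$. With $\alpha=[a_0;a_1,a_2,\dots]$ the continued fraction expansion, the denominators of convergents are indexed by $q_0=1$, $q_1=a_1$, $q_{n+1}=a_{n+1}q_n+q_{n-1}$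 (so $\{q_n\alpha\}_2>0$ for even $n\ge2$ and $\{q_n\alpha\}_2<0$ for odd $n$). A liminf along an index set that is finite or empty is taken to be $+\infty$. -}

module Defs where

open import Level using (0ℓ)
open import Algebra.Bundles using (CommutativeRing)
import Algebra.Properties.Ring as RingProperties
import Algebra.Properties.Semiring.Exp as Exp
import Algebra.Properties.Semiring.Mult as Mult
open import Axiom.ExcludedMiddle using (ExcludedMiddle)
open import Data.Empty using (⊥-elim)
open import Data.Integer.Base as ℤ using (ℤ; +_; -[1+_]; ∣_∣; _⊖_)
import Data.Integer.Properties as ℤₚ
open import Data.Nat.Base as ℕ using (ℕ; NonZero)
open import Data.Product.Base using (∃; _×_; _,_; proj₁; proj₂)
open import Data.Sum.Base using (inj₁; inj₂)
import Relation.Binary.Construct.Add.Extrema.Equality as ExtremaEquality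
import Relation.Binary.Construct.Add.Extrema.NonStrict as ExtremaOrder
import Relation.Binary.Construct.StrictToNonStrict as StrictToNonStrict
open import Relation.Binary.Core using (Rel)
open import Relation.Binary.Definitions using (tri<; tri≈; tri>)
open import Relation.Binary.PropositionalEquality.Core using (_≡_)
open import Relation.Binary.Structures using (IsStrictTotalOrder; IsTotalOrder)
open import Relation.Nullary.Construct.Add.Extrema using (_±; ⊥±; ⊤±; [_])
open import Relation.Nullary.Decidable.Core using (yes; no)
open import Relation.Nullary.Negation.Core using (¬_)

module _ {A : Set} (_≤_ : Rel A 0ℓ) (P : A → Set) where

  IsUpperBound IsLowerBound IsSup IsInf : A → Set
  IsUpperBound u = ∀ x → P x → x ≤ u
  IsLowerBound l = ∀ x → P x → l ≤ x
  IsSup s = IsUpperBound s × (∀ u → IsUpperBound u → s ≤ u)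
  IsInf i = IsLowerBound i × (∀ l → IsLowerBound l → l ≤ i)

-- The real numbers, axiomatised (up to unique isomorphism) as a Dedekind
-- complete ordered field.  The inverse is total; 0# ⁻¹ is left unspecified.

record CompleteOrderedField : Set₁ where
  infix 4 _<_
  infix 8 _⁻¹
  field
    commutativeRing : CommutativeRing 0ℓ 0ℓ
  open CommutativeRing commutativeRing public
  field
    _<_                : Rel Carrier 0ℓ
    isStrictTotalOrder : IsStrictTotalOrder _≈_ _<_
    +-monoˡ-<          : ∀ z {x y} → x < y → x + z < y + z
    *-pos              : ∀ {x y} → 0# < x → 0# < y → 0# < x * y
    0#<1#              : 0# < 1#
    _⁻¹                : Carrier → Carrier
    *-inverseʳ         : ∀ {x} → ¬ x ≈ 0# → x * x ⁻¹ ≈ 1#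
  open StrictToNonStrict _≈_ _<_ public using (_≤_)
  field
    complete : (P : Carrier → Set) → ∃ P → ∃ (IsUpperBound _≤_ P) →
               ∃ (IsSup _≤_ P)

module Analysis (em : ExcludedMiddle 0ℓ) (𝓡 : CompleteOrderedField) where

  open CompleteOrderedField 𝓡 public renaming (Carrier to ℝ)
  open Exp semiring public using (_^_)
  open Mult semiring using (×-homo-+) renaming (_×_ to _·_)
  open RingProperties ring using (-‿involutive; -0#≈0#; -‿+-comm; xyx⁻¹≈y)
  open import Relation.Binary.Reasoning.Setoid setoid

  open ExtremaEquality _≈_ public using (_≈±_)
  open ExtremaOrder _≤_ public using (_≤±_)

  private
    module Ex = ExtremaOrder _≤_
    module < = IsStrictTotalOrder isStrictTotalOrder
    module ≤ = IsTotalOrder (StrictToNonStrict.isTotalOrder _≈_ _<_ isStrictTotalOrder)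

    ≮⇒≥ : ∀ {x y} → ¬ x < y → y ≤ x
    ≮⇒≥ {x} {y} x≮y with <.compare x y
    ... | tri< x<y _ _ = ⊥-elim (x≮y x<y)
    ... | tri≈ _ x≈y _ = inj₂ (sym x≈y)
    ... | tri> _ _ y<x = inj₁ y<x

    <⇒≱ : ∀ {x y} → x < y → ¬ y ≤ x
    <⇒≱ x<y (inj₁ y<x) = <.asym x<y y<x
    <⇒≱ x<y (inj₂ y≈x) = <.irrefl (sym y≈x) x<y

    +-monoˡ-≤ : ∀ z {x y} → x ≤ y → x + z ≤ y + z
    +-monoˡ-≤ z (inj₁ x<y) = inj₁ (+-monoˡ-< z x<y)
    +-monoˡ-≤ z (inj₂ x≈y) = inj₂ (+-congʳ x≈y)

    x+y-y≈x : ∀ x y → (x + y) - y ≈ x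
    x+y-y≈x x y = trans (+-assoc x y (- y)) (trans (+-congˡ (-‿inverseʳ y)) (+-identityʳ x))

    x-y+y≈x : ∀ x y → (x - y) + y ≈ x
    x-y+y≈x x y = trans (+-assoc x (- y) y) (trans (+-congˡ (-‿inverseˡ y)) (+-identityʳ x))

    x-[x-y]≈y : ∀ x y → x - (x - y) ≈ y
    x-[x-y]≈y x y = begin
      x - (x - y)      ≈⟨ +-congˡ (-‿+-comm x (- y)) ⟨
      x + (- x - - y)  ≈⟨ +-assoc x (- x) (- - y) ⟨
      (x - x) - - y    ≈⟨ +-cong (-‿inverseʳ x) (-‿involutive y) ⟩
      0# + y           ≈⟨ +-identityˡ y ⟩
      y                ∎

    x-1<x : ∀ x → x - 1# < x
    x-1<x x = <.<-respʳ-≈ (x-y+y≈x x 1#)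
      (<.<-respˡ-≈ (+-identityˡ _) (<.<-respʳ-≈ (+-comm 1# _) (+-monoˡ-< (x - 1#) 0#<1#)))

  -- Completeness makes every set of extended reals have a supremum; the infimum
  -- is the supremum of the lower bounds.  In particular inf ∅ is ⊤±, i.e. +∞.

  sup∃ : (P : ℝ ± → Set) → ∃ (IsSup _≤±_ P)
  sup∃ P with em {∃ λ b → IsUpperBound _≤±_ P [ b ]}
  ... | no unbounded = ⊤± , (λ x _ → x Ex.≤⊤±) , least
    where
    least : ∀ u → IsUpperBound _≤±_ P u → ⊤± ≤± u
    least ⊤±    _  = ⊤± Ex.≤⊤±
    least [ b ] ub = ⊥-elim (unbounded (b , ub))
    least ⊥±    ub = ⊥-elim (unbounded (0# , λ x Px →
      Ex.≤±-trans ≤.trans (ub x Px) (Ex.⊥±≤ [ 0# ])))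
  ... | yes (b , ub) with em {∃ λ x → P [ x ]}
  ...   | no none = ⊥± , upper , (λ u _ → Ex.⊥±≤ u)
    where
    upper : IsUpperBound _≤±_ P ⊥±
    upper ⊥±    _  = Ex.⊥±≤ ⊥±
    upper [ x ] Px = ⊥-elim (none (x , Px))
    upper ⊤±    P⊤ with ub ⊤± P⊤
    ... | ()
  ...   | yes (x₀ , Px₀) = [ s ] , upper , least
    where
    s∃ = complete (λ x → P [ x ]) (x₀ , Px₀) (b , λ x Px → Ex.[≤]-injective (ub [ x ] Px))
    s  = proj₁ s∃

    upper : IsUpperBound _≤±_ P [ s ]
    upper ⊥±    _  = Ex.⊥±≤ [ s ]
    upper [ x ] Px = Ex.[ proj₁ (proj₂ s∃) x Px ]
    upper ⊤±    P⊤ with ub ⊤± P⊤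
    ... | ()

    least : ∀ u → IsUpperBound _≤±_ P u → [ s ] ≤± u
    least ⊤±    _   = [ s ] Ex.≤⊤±
    least [ c ] ub′ = Ex.[ proj₂ (proj₂ s∃) c (λ x Px → Ex.[≤]-injective (ub′ [ x ] Px)) ]
    least ⊥±    ub′ = ⊥-elim (<⇒≱ (x-1<x x₀) (Ex.[≤]-injective
      (Ex.≤±-trans ≤.trans (ub′ [ x₀ ] Px₀) (Ex.⊥±≤ [ x₀ - 1# ]))))

  inf∃ : (P : ℝ ± → Set) → ∃ (IsInf _≤±_ P)
  inf∃ P with sup∃ (IsLowerBound _≤±_ P)
  ... | i , upper , least = i , (λ x Px → least x (λ l lb → lb x Px)) , upper

  sup inf : (ℝ ± → Set) → ℝ ±
  sup P = proj₁ (sup∃ P)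
  inf P = proj₁ (inf∃ P)

  limInf : (S : ℕ → Set) → (ℕ → ℝ) → ℝ ±
  limInf S f = sup λ y → ∃ λ N →
    y ≡ inf (λ z → ∃ λ k → N ℕ.≤ k × S k × z ≡ [ f k ])

  fromℕ : ℕ → ℝ
  fromℕ n = n · 1#

  fromℤ : ℤ → ℝ
  fromℤ (+ n)    = fromℕ n
  fromℤ -[1+ n ] = - fromℕ (ℕ.suc n)

  infixl 7 _/ᴿ_
  _/ᴿ_ : ℤ → (q : ℕ) → .{{NonZero q}} → ℝ
  p /ᴿ q = fromℤ p * fromℕ q ⁻¹

  Irrational : ℝ → Set
  Irrational x = ∀ (p : ℤ) (q : ℕ) .{{_ : NonZero q}} → ¬ x ≈ p /ᴿ q

  -- Real powers of positive integers: for k ≥ 1 and β ≥ 0, k^β is the supremum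
  -- of k^(a/b) over the rationals 0 ≤ a/b ≤ β, and k^(a/b) is in turn the
  -- supremum of the x ≥ 0 with x^b ≤ k^a.  The set below contains 1 and is
  -- bounded, so `finite` only discards the constructor; for other arguments
  -- the value is irrelevant.

  finite : ℝ ± → ℝ
  finite [ x ] = x
  finite ⊥±    = 0#
  finite ⊤±    = 0#

  infixr 8 _^ᴿ_
  _^ᴿ_ : ℕ → ℝ → ℝ
  k ^ᴿ β = finite (sup λ y → ∃ λ x → y ≡ [ x ] × 0# ≤ x ×
    ∃ λ a → ∃ λ b → NonZero b × fromℕ a ≤ fromℕ b * β × x ^ b ≤ fromℕ k ^ a)

  archimedean : ∀ x → ∃ λ n → x < fromℕ n
  archimedean x with em {∃ λ n → x < fromℕ n}
  ... | yes x<n = x<n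
  ... | no  x≮n with complete (λ y → ∃ λ n → y ≈ fromℕ n) (0# , 0 , refl)
                     (x , λ y (n , y≈n) → ≤.trans (≤.reflexive y≈n) (≮⇒≥ (λ x<n → x≮n (n , x<n))))
  ...   | s , upper , least = ⊥-elim (<⇒≱ (x-1<x s) (least (s - 1#) λ y (n , y≈n) →
            ≤.trans (≤.reflexive (trans y≈n (sym (xyx⁻¹≈y 1# _))))
                    (+-monoˡ-≤ (- 1#) (upper _ (ℕ.suc n , refl)))))

  fromℤ-⊖ : ∀ m n → fromℤ (m ⊖ n) ≈ fromℕ m - fromℕ n
  fromℤ-⊖ m         ℕ.zero    = sym (trans (+-congˡ -0#≈0#) (+-identityʳ _))
  fromℤ-⊖ ℕ.zero    (ℕ.suc n) = sym (+-identityˡ _)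
  fromℤ-⊖ (ℕ.suc m) (ℕ.suc n) rewrite ℤₚ.[1+m]⊖[1+n]≡m⊖n m n = begin
    fromℤ (m ⊖ n)                        ≈⟨ fromℤ-⊖ m n ⟩
    fromℕ m - fromℕ n                    ≈⟨ +-congʳ (xyx⁻¹≈y 1# _) ⟨
    (1# + fromℕ m) - 1# - fromℕ n        ≈⟨ +-assoc _ _ _ ⟩
    (1# + fromℕ m) + (- 1# - fromℕ n)    ≈⟨ +-congˡ (-‿+-comm 1# _) ⟩
    (1# + fromℕ m) - (1# + fromℕ n)      ∎

  floor∃ : ∀ x → ∃ λ n → fromℤ n ≤ x × x < fromℤ n + 1#
  floor∃ x with em {∃ λ n → fromℤ n ≤ x × x < fromℤ n + 1#}
  ... | yes n = n
  ... | no none with archimedean (- x) | archimedean x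
  ...   | N , -x<N | M , x<M = ⊥-elim (<⇒≱ x<M (≤.trans (≤.reflexive M≈) (below (N ℕ.+ M))))
    where
    below : ∀ j → fromℤ (j ⊖ N) ≤ x
    below ℕ.zero = ≤.trans (≤.reflexive (trans (fromℤ-⊖ 0 N) (+-identityˡ _))) (inj₁
      (<.<-respˡ-≈ (trans (sym (+-assoc _ _ _)) (trans (+-congʳ (-‿inverseˡ x)) (+-identityˡ _)))
        (<.<-respʳ-≈ (trans (+-comm _ _) (x-y+y≈x x _)) (+-monoˡ-< (x - fromℕ N) -x<N))))
    below (ℕ.suc j) = ≤.trans (≤.reflexive step) (≮⇒≥ λ x<n+1 → none (j ⊖ N , below j , x<n+1))
      where
      step : fromℤ (ℕ.suc j ⊖ N) ≈ fromℤ (j ⊖ N) + 1#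
      step = begin
        fromℤ (ℕ.suc j ⊖ N)             ≈⟨ fromℤ-⊖ (ℕ.suc j) N ⟩
        (1# + fromℕ j) - fromℕ N        ≈⟨ +-assoc _ _ _ ⟩
        1# + (fromℕ j - fromℕ N)        ≈⟨ +-comm _ _ ⟩
        (fromℕ j - fromℕ N) + 1#        ≈⟨ +-congʳ (fromℤ-⊖ j N) ⟨
        fromℤ (j ⊖ N) + 1#              ∎
    M≈ : fromℕ M ≈ fromℤ ((N ℕ.+ M) ⊖ N)
    M≈ = sym (begin
      fromℤ ((N ℕ.+ M) ⊖ N)        ≈⟨ fromℤ-⊖ (N ℕ.+ M) N ⟩
      fromℕ (N ℕ.+ M) - fromℕ N    ≈⟨ +-congʳ (×-homo-+ 1# N M) ⟩
      (fromℕ N + fromℕ M) - fromℕ N  ≈⟨ xyx⁻¹≈y _ _ ⟩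
      fromℕ M                      ∎)

  ⌊_⌋ : ℝ → ℤ
  ⌊ x ⌋ = proj₁ (floor∃ x)

  ½ : ℝ
  ½ = (1# + 1#) ⁻¹

  ½+½≈1 : ½ + ½ ≈ 1#
  ½+½≈1 = begin
    ½ + ½                ≈⟨ +-cong (*-identityˡ ½) (*-identityˡ ½) ⟨
    1# * ½ + 1# * ½      ≈⟨ distribʳ ½ 1# 1# ⟨
    (1# + 1#) * ½        ≈⟨ *-inverseʳ (λ 2≈0 → <.irrefl (sym 2≈0)
                              (<.trans 0#<1# (<.<-respˡ-≈ (+-identityˡ 1#) (+-monoˡ-< 1# 0#<1#)))) ⟩
    1#                   ∎

  signedFrac∃ : ∀ x → ∃ λ y → (- ½ ≤ y × y < ½) × ∃ λ n → x - y ≈ fromℤ n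
  signedFrac∃ x with floor∃ (x + ½)
  ... | n , n≤x+½ , x+½<n+1 = x - fromℤ n , (lower , upper) , n , x-[x-y]≈y x (fromℤ n)
    where
    ν = fromℤ n

    lower : - ½ ≤ x - ν
    lower = ≤.trans (≤.reflexive (sym (begin
        ν + (- ν - ½)    ≈⟨ +-assoc ν (- ν) (- ½) ⟨
        (ν - ν) - ½      ≈⟨ +-congʳ (-‿inverseʳ ν) ⟩
        0# - ½           ≈⟨ +-identityˡ (- ½) ⟩
        - ½              ∎)))
      (≤.trans (+-monoˡ-≤ (- ν - ½) n≤x+½) (≤.reflexive (begin
        (x + ½) + (- ν - ½)    ≈⟨ +-congˡ (+-comm (- ν) (- ½)) ⟩
        (x + ½) + (- ½ - ν)    ≈⟨ +-assoc (x + ½) (- ½) (- ν) ⟨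
        ((x + ½) - ½) - ν      ≈⟨ +-congʳ (x+y-y≈x x ½) ⟩
        x - ν                  ∎)))

    upper : x - ν < ½
    upper = <.<-respˡ-≈ (begin
        (x + ½) + (- ½ - ν)    ≈⟨ +-assoc (x + ½) (- ½) (- ν) ⟨
        ((x + ½) - ½) - ν      ≈⟨ +-congʳ (x+y-y≈x x ½) ⟩
        x - ν                  ∎)
      (<.<-respʳ-≈ (begin
        (ν + 1#) + (- ½ - ν)        ≈⟨ +-cong (+-comm ν 1#) (+-comm (- ½) (- ν)) ⟩
        (1# + ν) + (- ν - ½)        ≈⟨ +-assoc (1# + ν) (- ν) (- ½) ⟨
        ((1# + ν) - ν) - ½          ≈⟨ +-congʳ (x+y-y≈x 1# ν) ⟩
        1# - ½                      ≈⟨ +-congʳ ½+½≈1 ⟨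
        (½ + ½) - ½                 ≈⟨ x+y-y≈x ½ ½ ⟩
        ½                           ∎)
      (+-monoˡ-< (- ½ - ν) x+½<n+1))

  signedFrac : ℝ → ℝ
  signedFrac x = proj₁ (signedFrac∃ x)

  μ₊ μ₋ : ℝ → ℝ → ℝ → ℝ ±
  μ₊ α β ρ = limInf (λ k → 1 ℕ.≤ k × 0# < signedFrac (fromℕ k * α - ρ))
                    (λ k → k ^ᴿ β * signedFrac (fromℕ k * α - ρ))
  μ₋ α β ρ = limInf (λ k → 1 ℕ.≤ k × signedFrac (fromℕ k * α - ρ) < 0#)
                    (λ k → - (k ^ᴿ β * signedFrac (fromℕ k * α - ρ)))

  -- α = [a₀; a₁, …, aₙ₋₁, αₙ], where αₙ = completeQuotient α n and aₙ = ⌊αₙ⌋.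

  completeQuotient : ℝ → ℕ → ℝ
  completeQuotient α ℕ.zero    = α
  completeQuotient α (ℕ.suc n) = (completeQuotient α n - fromℤ ⌊ completeQuotient α n ⌋) ⁻¹

  partialQuotient : ℝ → ℕ → ℤ
  partialQuotient α n = ⌊ completeQuotient α n ⌋

  -- Only aₙ with n ≥ 1 occurs; it is positive for irrational α, so ∣ aₙ ∣ is aₙ.

  denominator : ℝ → ℕ → ℕ
  denominator α 0             = 1
  denominator α 1             = ∣ partialQuotient α 1 ∣
  denominator α (ℕ.suc (ℕ.suc n)) =
    ∣ partialQuotient α (ℕ.suc (ℕ.suc n)) ∣ ℕ.* denominator α (ℕ.suc n) ℕ.+ denominator α n

{-# OPTIONS --safe #-}
module Submission where

open import Defs
open import Level using (0ℓ)
open import Algebra.Bundles using (RawRing)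
import Algebra.Properties.CommutativeSemiring.Exp as CommutativeExp
import Algebra.Properties.Ring as RingProperties
import Algebra.Properties.Semiring.Mult as Mult
import Algebra.Properties.Semiring.Mult.TCOptimised as MultTCOptimised
import Algebra.Solver.Ring as RingSolver
open import Algebra.Solver.Ring.AlmostCommutativeRing
  using (fromCommutativeRing; _-Raw-AlmostCommutative⟶_)
open import Axiom.ExcludedMiddle using (ExcludedMiddle)
open import Data.Empty using (⊥-elim)
open import Data.Integer.Base as ℤ using (ℤ; +_; -[1+_]; ∣_∣)
open import Data.Integer.Coprimality using (Coprime; coprime-divisor)
import Data.Integer.Divisibility.Signed as ℤ∣
open import Data.Integer.DivMod using (_%ℕ_; _/ℕ_; n%ℕd<d; a≡a%ℕn+[a/ℕn]*n)
open import Data.Integer.GCD using (gcd)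
import Data.Integer.Properties as ℤₚ
open import Data.Integer.Tactic.RingSolver using () renaming (solve-∀ to ℤ-solve-∀)
open import Data.Maybe.Base using (Maybe; just; nothing)
open import Data.Nat.Base as ℕ using (ℕ; NonZero; _∸_)
open import Data.Nat.Coprimality using (gcd≡1⇒coprime)
open import Data.Nat.Divisibility as ℕ∣ using (_∣_)
import Data.Nat.Properties as ℕₚ
open import Data.Product.Base using (_×_; _,_; ∃; proj₁; proj₂)
open import Data.Sign.Base as Sign using (Sign)
open import Data.Sign.Properties using (opposite-involutive)
open import Data.Sum.Base using (_⊎_; inj₁; inj₂)
open import Function.Bundles using (_⇔_; mk⇔; Equivalence)
open import Relation.Binary.Bundles using (StrictPartialOrder)
import Relation.Binary.Construct.Add.Extrema.NonStrict as ExtremaOrder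
import Relation.Binary.Construct.Add.Supremum.NonStrict as Supremum
import Relation.Binary.Construct.StrictToNonStrict as StrictToNonStrict
open import Relation.Binary.Definitions using (tri<; tri≈; tri>)
open import Relation.Binary.PropositionalEquality.Core as ≡ using (_≡_)
import Relation.Binary.Reasoning.StrictPartialOrder as StrictPartialOrderReasoning
open import Relation.Binary.Structures using (IsStrictTotalOrder; IsTotalOrder)
open import Relation.Nullary.Construct.Add.Extrema using ([_]; ⊥±; ⊤±; _±)
open import Relation.Nullary.Decidable.Core using (yes; no)
open import Relation.Nullary.Negation.Core using (¬_)

-- Write δ_j = q_j α − p_j, which has sign (−1)^j, and E_j = ∣δ_j∣.  If kα − p/q is at
-- signed distance s from an integer m, then q k α − (p + q m) = q s, and k s is small
-- because k ≤ k^β; so (p + q m)/(q k) is a convergent p_j/q_j whose parity is the sign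
-- of s.  Since p + q m is prime to q, q divides q_j; since q_j divides q k, E_j ≤ q ∣s∣
-- and q_j^β E_j is at most a constant times k^β ∣s∣.  Conversely, if q divides q_j, some
-- k ≤ q_j satisfies k p_j ≡ p q_j / q modulo q_j, and then kα − p/q is at signed
-- distance k δ_j / q_j from an integer.  As the terms of both lower limits are positive,
-- each lower limit vanishes exactly when its terms get arbitrarily small.

-- That the fraction is a convergent rests on integrality: an integer of absolute value below 1 is
-- 0. With K = q k, the index j is chosen where the denominators cross 2K, so that both halves of
-- the estimate stay below 1/2. This also decides the parity: with opposite signs the same integer
-- would be, up to sign, a sum of two positive numbers that is still below 1. Two obstacles shape
-- the rest. The real power is given only as a supremum of rational powers; in place of its
-- multiplicativity there is the cruder bound (q k)^β ≤ q^B k^β with an integer B above β, which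
-- costs only a constant. And the lower limit over denominators starts at index 1, because q_0 α can
-- be further than 1/2 from p_0; a convergent of index 0 is kept out by asking for values below E_0,
-- which is at most q_0^β E_0. Both signs are handled at once: a parameter σ multiplies every signed
-- distance, so that all quantities compared are positive.

parity : ℕ → Sign
parity ℕ.zero    = Sign.+
parity (ℕ.suc n) = Sign.opposite (parity n)

parity-even : ∀ n → parity (2 ℕ.* n) ≡ Sign.+
parity-even ℕ.zero    = ≡.refl
parity-even (ℕ.suc n) = ≡.trans (≡.cong parity (ℕₚ.*-suc 2 n))
  (≡.cong (λ σ → Sign.opposite (Sign.opposite σ)) (parity-even n))

parity-odd : ∀ n → parity (ℕ.suc (2 ℕ.* n)) ≡ Sign.-
parity-odd n = ≡.cong Sign.opposite (parity-even n)

even-or-odd : ∀ j → ∃ λ n → j ≡ 2 ℕ.* n ⊎ j ≡ ℕ.suc (2 ℕ.* n)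
even-or-odd ℕ.zero = 0 , inj₁ ≡.refl
even-or-odd (ℕ.suc j) with even-or-odd j
... | n , inj₁ ≡.refl = n , inj₂ ≡.refl
... | n , inj₂ ≡.refl = ℕ.suc n , inj₁ (≡.sym (ℕₚ.*-suc 2 n))

2*suc∸1 : ∀ n → 2 ℕ.* ℕ.suc n ∸ 1 ≡ ℕ.suc (2 ℕ.* n)
2*suc∸1 n = ≡.cong (_∸ 1) (ℕₚ.*-suc 2 n)

even-index-valid : ∀ n → 1 ℕ.≤ n → 1 ℕ.≤ 2 ℕ.* n × parity (2 ℕ.* n) ≡ Sign.+
even-index-valid n 1≤n = ℕₚ.≤-trans 1≤n (ℕₚ.m≤n*m n 2) , parity-even n

-- Truncated subtraction is harmless because `n` is at least 1; at `n = 0` the index would be 0,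
-- which is even.
odd-index-valid : ∀ n → 1 ℕ.≤ n → 1 ℕ.≤ 2 ℕ.* n ∸ 1 × parity (2 ℕ.* n ∸ 1) ≡ Sign.-
odd-index-valid (ℕ.suc n) _ =
  ≡.subst (1 ℕ.≤_) (≡.sym (2*suc∸1 n)) (ℕ.s≤s ℕ.z≤n) ,
  ≡.trans (≡.cong parity (2*suc∸1 n)) (parity-odd n)

even-index-onto : ∀ j → 1 ℕ.≤ j → parity j ≡ Sign.+ → ∃ λ n → 1 ℕ.≤ n × j ≡ 2 ℕ.* n
even-index-onto j 1≤j par with even-or-odd j
... | ℕ.suc n , inj₁ j≡ = ℕ.suc n , ℕ.s≤s ℕ.z≤n , j≡
... | ℕ.zero  , inj₁ ≡.refl = ⊥-elim (ℕₚ.n≮0 1≤j)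
... | n       , inj₂ ≡.refl with ≡.trans (≡.sym par) (parity-odd n)
...   | ()

odd-index-onto : ∀ j → 1 ℕ.≤ j → parity j ≡ Sign.- → ∃ λ n → 1 ℕ.≤ n × j ≡ 2 ℕ.* n ∸ 1
odd-index-onto j _ par with even-or-odd j
... | n , inj₂ j≡ = ℕ.suc n , ℕ.s≤s ℕ.z≤n , ≡.trans j≡ (≡.sym (2*suc∸1 n))
... | n , inj₁ ≡.refl with ≡.trans (≡.sym par) (parity-even n)
...   | ()

module Reals (em : ExcludedMiddle 0ℓ) (𝓡 : CompleteOrderedField) where

  open Analysis em 𝓡
  open RingProperties ring using (-0#≈0#; -‿+-comm; -‿involutive; -‿distribˡ-*; -‿distribʳ-*)
  open Mult semiring using (×-homo-+; ×1-homo-*)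
  private module ×′ = MultTCOptimised semiring

  module < = IsStrictTotalOrder isStrictTotalOrder
  module ≤ = IsTotalOrder (StrictToNonStrict.isTotalOrder _≈_ _<_ isStrictTotalOrder)

  strictPartialOrder : StrictPartialOrder 0ℓ 0ℓ 0ℓ
  strictPartialOrder = record { isStrictPartialOrder = <.isStrictPartialOrder }

  open StrictPartialOrderReasoning strictPartialOrder

  -- The embedding of the integers

  fromℕ-+ : ∀ m n → fromℕ (m ℕ.+ n) ≈ fromℕ m + fromℕ n
  fromℕ-+ = ×-homo-+ 1#

  fromℕ-* : ∀ m n → fromℕ (m ℕ.* n) ≈ fromℕ m * fromℕ n
  fromℕ-* = ×1-homo-*

  fromℕ-1 : fromℕ 1 ≈ 1#
  fromℕ-1 = +-identityʳ 1#

  fromℤ-+ : ∀ i j → fromℤ (i ℤ.+ j) ≈ fromℤ i + fromℤ j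
  fromℤ-+ (+ m)    (+ n)    = fromℕ-+ m n
  fromℤ-+ (+ m)    -[1+ n ] = fromℤ-⊖ m (ℕ.suc n)
  fromℤ-+ -[1+ m ] (+ n)    = trans (fromℤ-⊖ n (ℕ.suc m)) (+-comm _ _)
  fromℤ-+ -[1+ m ] -[1+ n ] = begin-equality
    - fromℕ (2 ℕ.+ (m ℕ.+ n))                ≡⟨ ≡.cong (λ k → - fromℕ (ℕ.suc k)) (ℕₚ.+-suc m n) ⟨
    - fromℕ (ℕ.suc m ℕ.+ ℕ.suc n)            ≈⟨ -‿cong (fromℕ-+ (ℕ.suc m) (ℕ.suc n)) ⟩
    - (fromℕ (ℕ.suc m) + fromℕ (ℕ.suc n))    ≈⟨ -‿+-comm _ _ ⟨
    - fromℕ (ℕ.suc m) - fromℕ (ℕ.suc n)      ∎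

  fromℤ-neg : ∀ i → fromℤ (ℤ.- i) ≈ - fromℤ i
  fromℤ-neg (+ ℕ.zero)  = sym -0#≈0#
  fromℤ-neg (+ ℕ.suc n) = refl
  fromℤ-neg -[1+ n ]    = sym (-‿involutive _)

  fromℤ-*-pos : ∀ i n → fromℤ (i ℤ.* + n) ≈ fromℤ i * fromℕ n
  fromℤ-*-pos (+ m)    n rewrite ≡.sym (ℤₚ.pos-* m n) = fromℕ-* m n
  fromℤ-*-pos -[1+ m ] n = begin-equality
    fromℤ (ℤ.- + ℕ.suc m ℤ.* + n)      ≡⟨ ≡.cong fromℤ (ℤₚ.neg-distribˡ-* (+ ℕ.suc m) (+ n)) ⟨
    fromℤ (ℤ.- (+ ℕ.suc m ℤ.* + n))    ≈⟨ fromℤ-neg (+ ℕ.suc m ℤ.* + n) ⟩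
    - fromℤ (+ ℕ.suc m ℤ.* + n)        ≈⟨ -‿cong (fromℤ-*-pos (+ ℕ.suc m) n) ⟩
    - (fromℕ (ℕ.suc m) * fromℕ n)      ≈⟨ -‿distribˡ-* _ _ ⟩
    - fromℕ (ℕ.suc m) * fromℕ n        ∎

  fromℤ-* : ∀ i j → fromℤ (i ℤ.* j) ≈ fromℤ i * fromℤ j
  fromℤ-* i (+ n)    = fromℤ-*-pos i n
  fromℤ-* i -[1+ n ] = begin-equality
    fromℤ (i ℤ.* (ℤ.- + ℕ.suc n))      ≡⟨ ≡.cong fromℤ (ℤₚ.neg-distribʳ-* i (+ ℕ.suc n)) ⟨
    fromℤ (ℤ.- (i ℤ.* + ℕ.suc n))      ≈⟨ fromℤ-neg (i ℤ.* + ℕ.suc n) ⟩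
    - fromℤ (i ℤ.* + ℕ.suc n)          ≈⟨ -‿cong (fromℤ-*-pos i (ℕ.suc n)) ⟩
    - (fromℤ i * fromℕ (ℕ.suc n))      ≈⟨ -‿distribʳ-* _ _ ⟩
    fromℤ i * - fromℕ (ℕ.suc n)        ∎

  -- The solver evaluates its integer coefficients with this variant of fromℤ,
  -- which sends 1 to 1# (and not to 1# + 0#).

  private
    coefficient : ℤ → ℝ
    coefficient (+ n)    = n ×′.× 1#
    coefficient -[1+ n ] = - (ℕ.suc n ×′.× 1#)

    fromℤ≈coefficient : ∀ i → fromℤ i ≈ coefficient i
    fromℤ≈coefficient (+ n)    = ×′.×ᵤ≈× n 1#
    fromℤ≈coefficient -[1+ n ] = -‿cong (×′.×ᵤ≈× (ℕ.suc n) 1#)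

    ℤ-rawRing : RawRing 0ℓ 0ℓ
    ℤ-rawRing = record
      { Carrier = ℤ ; _≈_ = _≡_ ; _+_ = ℤ._+_ ; _*_ = ℤ._*_ ; -_ = ℤ.-_ ; 0# = + 0 ; 1# = + 1 }

    coefficient-morphism : ℤ-rawRing -Raw-AlmostCommutative⟶ fromCommutativeRing commutativeRing
    coefficient-morphism = record
      { ⟦_⟧    = coefficient
      ; +-homo = λ i j → trans (sym (fromℤ≈coefficient (i ℤ.+ j))) (trans (fromℤ-+ i j)
                   (+-cong (fromℤ≈coefficient i) (fromℤ≈coefficient j)))
      ; *-homo = λ i j → trans (sym (fromℤ≈coefficient (i ℤ.* j))) (trans (fromℤ-* i j)
                   (*-cong (fromℤ≈coefficient i) (fromℤ≈coefficient j)))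
      ; -‿homo = λ i → trans (sym (fromℤ≈coefficient (ℤ.- i))) (trans (fromℤ-neg i)
                   (-‿cong (fromℤ≈coefficient i)))
      ; 0-homo = refl
      ; 1-homo = refl
      }

    coefficient-≟ : ∀ i j → Maybe (coefficient i ≈ coefficient j)
    coefficient-≟ i j with i ℤₚ.≟ j
    ... | yes ≡.refl = just refl
    ... | no  _      = nothing

  open RingSolver ℤ-rawRing (fromCommutativeRing commutativeRing) coefficient-morphism coefficient-≟
    using (solve; _:=_; _:+_; _:*_; _:-_; :-_; con)

  -- Order

  x<y⇒0<y-x : ∀ {x y} → x < y → 0# < y - x
  x<y⇒0<y-x {x} x<y = <.<-respˡ-≈ (-‿inverseʳ x) (+-monoˡ-< (- x) x<y)

  x≤y⇒0≤y-x : ∀ {x y} → x ≤ y → 0# ≤ y - x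
  x≤y⇒0≤y-x     (inj₁ x<y) = inj₁ (x<y⇒0<y-x x<y)
  x≤y⇒0≤y-x {x} (inj₂ x≈y) = inj₂ (trans (sym (-‿inverseʳ x)) (+-congʳ x≈y))

  y≈x+d⇒x<y : ∀ {x y d} → 0# < d → y ≈ x + d → x < y
  y≈x+d⇒x<y {x} {y} {d} 0<d y≈x+d = begin-strict
    x       ≈⟨ +-identityˡ x ⟨
    0# + x  <⟨ +-monoˡ-< x 0<d ⟩
    d + x   ≈⟨ +-comm d x ⟩
    x + d   ≈⟨ y≈x+d ⟨
    y       ∎

  y≈x+d⇒x≤y : ∀ {x y d} → 0# ≤ d → y ≈ x + d → x ≤ y
  y≈x+d⇒x≤y (inj₁ 0<d) y≈x+d = inj₁ (y≈x+d⇒x<y 0<d y≈x+d)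
  y≈x+d⇒x≤y (inj₂ 0≈d) y≈x+d = inj₂ (sym (trans y≈x+d (trans (+-congˡ (sym 0≈d)) (+-identityʳ _))))

  <⇒≱ : ∀ {x y} → x < y → ¬ y ≤ x
  <⇒≱ x<y (inj₁ y<x) = <.asym x<y y<x
  <⇒≱ x<y (inj₂ y≈x) = <.irrefl (sym y≈x) x<y

  ≮⇒≥ : ∀ {x y} → ¬ x < y → y ≤ x
  ≮⇒≥ {x} {y} x≮y with <.compare x y
  ... | tri< x<y _ _ = ⊥-elim (x≮y x<y)
  ... | tri≈ _ x≈y _ = inj₂ (sym x≈y)
  ... | tri> _ _ y<x = inj₁ y<x

  ≤∧≉⇒< : ∀ {x y} → x ≤ y → ¬ x ≈ y → x < y
  ≤∧≉⇒< (inj₁ x<y) _   = x<y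
  ≤∧≉⇒< (inj₂ x≈y) x≉y = ⊥-elim (x≉y x≈y)

  +-mono-< : ∀ {x y u v} → x < y → u < v → x + u < y + v
  +-mono-< {x} {y} {u} {v} x<y u<v = begin-strict
    x + u  <⟨ +-monoˡ-< u x<y ⟩
    y + u  ≈⟨ +-comm y u ⟩
    u + y  <⟨ +-monoˡ-< y u<v ⟩
    v + y  ≈⟨ +-comm v y ⟩
    y + v  ∎

  +-pos : ∀ {x y} → 0# < x → 0# < y → 0# < x + y
  +-pos 0<x 0<y = <.<-respˡ-≈ (+-identityˡ 0#) (+-mono-< 0<x 0<y)

  neg-mono-< : ∀ {x y} → x < y → - y < - x
  neg-mono-< {x} {y} x<y = y≈x+d⇒x<y (x<y⇒0<y-x x<y)
    (solve 2 (λ x y → :- x := :- y :+ (y :- x)) refl x y)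

  *-nonNeg : ∀ {x y} → 0# ≤ x → 0# ≤ y → 0# ≤ x * y
  *-nonNeg         (inj₁ 0<x) (inj₁ 0<y) = inj₁ (*-pos 0<x 0<y)
  *-nonNeg {x}     (inj₁ _)   (inj₂ 0≈y) = inj₂ (trans (sym (zeroʳ x)) (*-congˡ 0≈y))
  *-nonNeg {_} {y} (inj₂ 0≈x) _          = inj₂ (trans (sym (zeroˡ y)) (*-congʳ 0≈x))

  *-monoˡ-< : ∀ {z x y} → 0# < z → x < y → z * x < z * y
  *-monoˡ-< {z} {x} {y} 0<z x<y = y≈x+d⇒x<y (*-pos 0<z (x<y⇒0<y-x x<y))
    (solve 3 (λ z x y → z :* y := z :* x :+ z :* (y :- x)) refl z x y)

  *-monoˡ-≤ : ∀ {z x y} → 0# ≤ z → x ≤ y → z * x ≤ z * y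
  *-monoˡ-≤ {z} {x} {y} 0≤z x≤y = y≈x+d⇒x≤y (*-nonNeg 0≤z (x≤y⇒0≤y-x x≤y))
    (solve 3 (λ z x y → z :* y := z :* x :+ z :* (y :- x)) refl z x y)

  *-monoʳ-≤ : ∀ {z x y} → 0# ≤ z → x ≤ y → x * z ≤ y * z
  *-monoʳ-≤ {z} {x} {y} 0≤z x≤y = begin
    x * z  ≈⟨ *-comm x z ⟩
    z * x  ≤⟨ *-monoˡ-≤ 0≤z x≤y ⟩
    z * y  ≈⟨ *-comm z y ⟩
    y * z  ∎

  *-mono-≤ : ∀ {x y u v} → 0# ≤ u → 0# ≤ y → x ≤ y → u ≤ v → x * u ≤ y * v
  *-mono-≤ 0≤u 0≤y x≤y u≤v = ≤.trans (*-monoʳ-≤ 0≤u x≤y) (*-monoˡ-≤ 0≤y u≤v)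

  *-cancelˡ-≤ : ∀ {z x y} → 0# < z → z * x ≤ z * y → x ≤ y
  *-cancelˡ-≤ 0<z zx≤zy = ≮⇒≥ (λ y<x → <⇒≱ (*-monoˡ-< 0<z y<x) zx≤zy)

  *-cancelˡ-< : ∀ {z x y} → 0# ≤ z → z * x < z * y → x < y
  *-cancelˡ-< {z} {x} {y} 0≤z zx<zy with <.compare x y
  ... | tri< x<y _ _ = x<y
  ... | tri≈ _ x≈y _ = ⊥-elim (<.irrefl (*-congˡ x≈y) zx<zy)
  ... | tri> _ _ y<x = ⊥-elim (<⇒≱ zx<zy (*-monoˡ-≤ 0≤z (inj₁ y<x)))

  *-cancelˡ-≈ : ∀ {z x y} → 0# < z → z * x ≈ z * y → x ≈ y
  *-cancelˡ-≈ 0<z zx≈zy = ≤.antisym (*-cancelˡ-≤ 0<z (≤.reflexive zx≈zy))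
                                    (*-cancelˡ-≤ 0<z (≤.reflexive (sym zx≈zy)))

  *-pos⁻ : ∀ {x y} → 0# ≤ x → 0# < x * y → 0# < y
  *-pos⁻ {x} 0≤x 0<xy = *-cancelˡ-< 0≤x (<.<-respˡ-≈ (sym (zeroʳ x)) 0<xy)

  ⁻¹-pos : ∀ {x} → 0# < x → 0# < x ⁻¹
  ⁻¹-pos 0<x = *-pos⁻ (inj₁ 0<x)
    (<.<-respʳ-≈ (sym (*-inverseʳ (λ x≈0 → <.irrefl (sym x≈0) 0<x))) 0#<1#)

  positive-lowerBound : ∀ {x y} → 0# < x → 0# < y → ∃ λ m → 0# < m × m ≤ x × m ≤ y
  positive-lowerBound {x} {y} 0<x 0<y with ≤.total x y
  ... | inj₁ x≤y = x , 0<x , ≤.refl , x≤y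
  ... | inj₂ y≤x = y , 0<y , y≤x , ≤.refl

  fromℕ-mono-≤ : ∀ {m n} → m ℕ.≤ n → fromℕ m ≤ fromℕ n
  fromℕ-nonNeg : ∀ n → 0# ≤ fromℕ n

  fromℕ-nonNeg ℕ.zero    = ≤.refl
  fromℕ-nonNeg (ℕ.suc n) = ≤.trans (fromℕ-nonNeg n)
    (y≈x+d⇒x≤y (inj₁ 0#<1#) (+-comm 1# (fromℕ n)))

  fromℕ-mono-≤ {n = n} ℕ.z≤n = fromℕ-nonNeg n
  fromℕ-mono-≤ {ℕ.suc m} {ℕ.suc n} (ℕ.s≤s m≤n) = begin
    1# + fromℕ m  ≈⟨ +-comm 1# (fromℕ m) ⟩
    fromℕ m + 1#  ≤⟨ y≈x+d⇒x≤y (x≤y⇒0≤y-x (fromℕ-mono-≤ m≤n))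
                       (solve 3 (λ x y z → y :+ z := (x :+ z) :+ (y :- x)) refl (fromℕ m) (fromℕ n) 1#) ⟩
    fromℕ n + 1#  ≈⟨ +-comm (fromℕ n) 1# ⟩
    1# + fromℕ n  ∎

  1≤fromℕ : ∀ {n} → 1 ℕ.≤ n → 1# ≤ fromℕ n
  1≤fromℕ 1≤n = ≤.trans (≤.reflexive (sym fromℕ-1)) (fromℕ-mono-≤ 1≤n)

  fromℕ-pos : ∀ {n} → 1 ℕ.≤ n → 0# < fromℕ n
  fromℕ-pos {n} 1≤n = begin-strict
    0#       <⟨ 0#<1# ⟩
    1#       ≤⟨ 1≤fromℕ 1≤n ⟩
    fromℕ n  ∎

  fromℤ-small⇒0 : ∀ i → - 1# < fromℤ i → fromℤ i < 1# → i ≡ + 0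
  fromℤ-small⇒0 (+ ℕ.zero)  _    _   = ≡.refl
  fromℤ-small⇒0 (+ ℕ.suc n) _    i<1 = ⊥-elim (<⇒≱ i<1 (1≤fromℕ (ℕ.s≤s (ℕ.z≤n {n}))))
  fromℤ-small⇒0 -[1+ n ]    -1<i _   = ⊥-elim (<⇒≱ -1<i (neg-mono-≤ (1≤fromℕ (ℕ.s≤s (ℕ.z≤n {n})))))
    where
    neg-mono-≤ : ∀ {x y} → x ≤ y → - y ≤ - x
    neg-mono-≤ (inj₁ x<y) = inj₁ (neg-mono-< x<y)
    neg-mono-≤ (inj₂ x≈y) = inj₂ (-‿cong (sym x≈y))

  fromℤ-pos⁻ : ∀ i → 0# < fromℤ i → + ∣ i ∣ ≡ i × 1 ℕ.≤ ∣ i ∣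
  fromℤ-pos⁻ (+ ℕ.zero)  0<0 = ⊥-elim (<.irrefl refl 0<0)
  fromℤ-pos⁻ (+ ℕ.suc n) _   = ≡.refl , ℕ.s≤s ℕ.z≤n
  fromℤ-pos⁻ -[1+ n ]    0<i = ⊥-elim (<.asym 0<i
    (<.<-respʳ-≈ -0#≈0# (neg-mono-< (fromℕ-pos {ℕ.suc n} (ℕ.s≤s ℕ.z≤n)))))

  -- Lets the ring solver use a hypothesis `u ≈ v`: once the right multiple `c` of `u - v` is added
  -- to `b`, the remaining goal is a polynomial identity.
  modulo : ∀ {u v} c {a b} → u ≈ v → a ≈ b + c * (u - v) → a ≈ b
  modulo {u} {v} c {a} {b} u≈v a≈ = begin-equality
    a                ≈⟨ a≈ ⟩
    b + c * (u - v)  ≈⟨ +-congˡ (*-congˡ (+-congʳ u≈v)) ⟩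
    b + c * (v - v)  ≈⟨ solve 3 (λ b c v → b :+ c :* (v :- v) := b) refl b c v ⟩
    b                ∎

  -- Signs

  sgn : Sign → ℝ
  sgn Sign.+ = 1#
  sgn Sign.- = - 1#

  sgn-opposite : ∀ σ → sgn (Sign.opposite σ) ≈ - sgn σ
  sgn-opposite Sign.+ = refl
  sgn-opposite Sign.- = sym (-‿involutive 1#)

  sgn-* : ∀ σ → sgn σ * sgn σ ≈ 1#
  sgn-* Sign.+ = *-identityˡ 1#
  sgn-* Sign.- = solve 0 (:- con (+ 1) :* :- con (+ 1) := con (+ 1)) refl

  sgn-bounds : ∀ σ {x b} → - b < x → x < b → - b < sgn σ * x × sgn σ * x < b
  sgn-bounds Sign.+ {x} -b<x x<b =
    <.<-respʳ-≈ (sym (*-identityˡ x)) -b<x , <.<-respˡ-≈ (sym (*-identityˡ x)) x<b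
  sgn-bounds Sign.- {x} {b} -b<x x<b =
    <.<-respʳ-≈ -x (neg-mono-< x<b) ,
    <.<-respˡ-≈ -x (<.<-respʳ-≈ (-‿involutive b) (neg-mono-< -b<x))
    where
    -x : - x ≈ - 1# * x
    -x = solve 1 (λ x → :- x := :- con (+ 1) :* x) refl x

  <0⇔0<-1* : ∀ x → x < 0# ⇔ 0# < - 1# * x
  <0⇔0<-1* x = mk⇔
    (λ x<0 → <.<-respʳ-≈ (solve 1 (λ x → con (+ 0) :- x := :- con (+ 1) :* x) refl x) (x<y⇒0<y-x x<0))
    (λ 0<-x → y≈x+d⇒x<y 0<-x (solve 1 (λ x → con (+ 0) := x :+ :- con (+ 1) :* x) refl x))

  -*≈*-1* : ∀ x y → - (x * y) ≈ x * (- 1# * y)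
  -*≈*-1* x y = solve 2 (λ x y → :- (x :* y) := x :* (:- con (+ 1) :* y)) refl x y

  same-or-opposite : ∀ σ τ → σ ≡ τ ⊎ σ ≡ Sign.opposite τ
  same-or-opposite Sign.+ Sign.+ = inj₁ ≡.refl
  same-or-opposite Sign.+ Sign.- = inj₂ ≡.refl
  same-or-opposite Sign.- Sign.+ = inj₂ ≡.refl
  same-or-opposite Sign.- Sign.- = inj₁ ≡.refl

  sgn-sgn-* : ∀ σ x → sgn σ * (sgn σ * x) ≈ x
  sgn-sgn-* σ x = trans (sym (*-assoc (sgn σ) (sgn σ) x)) (trans (*-congʳ (sgn-* σ)) (*-identityˡ x))

  sgn-integer : ∀ σ i {x} → fromℤ i ≈ sgn σ * x → - 1# < x → x < 1# → i ≡ + 0 × x ≈ 0#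
  sgn-integer σ i {x} i≈ -1<x x<1 = i≡0 , (begin-equality
    x                    ≈⟨ sgn-sgn-* σ x ⟨
    sgn σ * (sgn σ * x)  ≈⟨ *-congˡ (trans (sym i≈) (reflexive (≡.cong fromℤ i≡0))) ⟩
    sgn σ * 0#           ≈⟨ zeroʳ (sgn σ) ⟩
    0#                   ∎)
    where
    bounds = sgn-bounds σ -1<x x<1
    i≡0 : i ≡ + 0
    i≡0 = fromℤ-small⇒0 i (<.<-respʳ-≈ (sym i≈) (proj₁ bounds)) (<.<-respˡ-≈ (sym i≈) (proj₂ bounds))

  -- The value chosen through `floor∃` and the candidate `y` differ by an integer of absolute value
  -- below 1.
  signedFrac-unique : ∀ {x y} n → x - y ≈ fromℤ n → - ½ < y → y < ½ → signedFrac x ≈ y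
  signedFrac-unique {x} {y} n x-y≈n -½<y y<½ = begin-equality
    s            ≈⟨ solve 2 (λ s y → s := (s :- y) :+ y) refl s y ⟩
    (s - y) + y  ≈⟨ +-congʳ (trans s-y≈ (reflexive (≡.cong fromℤ n-m≡0))) ⟩
    0# + y       ≈⟨ +-identityˡ y ⟩
    y            ∎
    where
    s = signedFrac x
    -½≤s = proj₁ (proj₁ (proj₂ (signedFrac∃ x)))
    s<½ = proj₂ (proj₁ (proj₂ (signedFrac∃ x)))
    m = proj₁ (proj₂ (proj₂ (signedFrac∃ x)))
    x-s≈m : x - s ≈ fromℤ m
    x-s≈m = proj₂ (proj₂ (proj₂ (signedFrac∃ x)))
    s-y≈ : s - y ≈ fromℤ (n ℤ.- m)
    s-y≈ = begin-equality
      s - y              ≈⟨ solve 3 (λ s x y → s :- y := (x :- y) :- (x :- s)) refl s x y ⟩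
      (x - y) - (x - s)  ≈⟨ +-cong x-y≈n (-‿cong x-s≈m) ⟩
      fromℤ n - fromℤ m  ≈⟨ +-congˡ (fromℤ-neg m) ⟨
      fromℤ n + fromℤ (ℤ.- m)  ≈⟨ fromℤ-+ n (ℤ.- m) ⟨
      fromℤ (n ℤ.- m)    ∎
    lower : - 1# < s - y
    lower = begin-strict
      - 1#         ≈⟨ -‿cong ½+½≈1 ⟨
      - (½ + ½)    ≈⟨ -‿+-comm ½ ½ ⟨
      - ½ - ½      <⟨ y≈x+d⇒x<y (x<y⇒0<y-x (neg-mono-< y<½))
          (solve 2 (λ y h → :- h :- y := (:- h :- h) :+ (:- y :- :- h)) refl y ½) ⟩
      - ½ - y      ≤⟨ y≈x+d⇒x≤y (x≤y⇒0≤y-x -½≤s) (solve 3 (λ s y h → s :- y := (h :- y) :+ (s :- h))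
            refl s y (- ½)) ⟩
      s - y        ∎
    upper : s - y < 1#
    upper = begin-strict
      s - y        <⟨ +-mono-< s<½ (neg-mono-< -½<y) ⟩
      ½ - - ½      ≈⟨ +-congˡ (-‿involutive ½) ⟩
      ½ + ½        ≈⟨ ½+½≈1 ⟩
      1#           ∎
    n-m≡0 : n ℤ.- m ≡ + 0
    n-m≡0 = fromℤ-small⇒0 (n ℤ.- m) (<.<-respʳ-≈ s-y≈ lower) (<.<-respˡ-≈ s-y≈ upper)

  0<½ : 0# < ½
  0<½ = ⁻¹-pos (+-pos 0#<1# 0#<1#)

  <½ : ∀ {x} → x + x < 1# → x < ½
  <½ {x} x+x<1 = ≰⇒> λ ½≤x → <⇒≱ x+x<1 (begin
    1#     ≈⟨ ½+½≈1 ⟨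
    ½ + ½  ≤⟨ y≈x+d⇒x≤y (*-nonNeg (inj₁ (+-pos 0#<1# 0#<1#)) (x≤y⇒0≤y-x ½≤x))
                (solve 2 (λ x h → x :+ x := (h :+ h) :+ (con (+ 1) :+ con (+ 1)) :* (x :- h)) refl x ½) ⟩
    x + x  ∎)
    where
    ≰⇒> : ∀ {x y} → ¬ y ≤ x → x < y
    ≰⇒> {x} {y} y≰x with <.compare x y
    ... | tri< x<y _ _ = x<y
    ... | tri≈ _ x≈y _ = ⊥-elim (y≰x (inj₂ (sym x≈y)))
    ... | tri> _ _ y<x = ⊥-elim (y≰x (inj₁ y<x))

  signedFrac-sgn : ∀ σ {x y} n → x - sgn σ * y ≈ fromℤ n → 0# < y → y + y < 1# →
                   signedFrac x ≈ sgn σ * y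
  signedFrac-sgn σ {x} {y} n eq 0<y 2y<1 = signedFrac-unique n eq (proj₁ bounds) (proj₂ bounds)
    where
    bounds = sgn-bounds σ (<.trans (<.<-respʳ-≈ -0#≈0# (neg-mono-< 0<½)) 0<y) (<½ 2y<1)

  -- Lower limits

  module ≤± = ExtremaOrder _≤_

  ≤±-trans : ∀ {x y z} → x ≤± y → y ≤± z → x ≤± z
  ≤±-trans = ≤±.≤±-trans ≤.trans

  module _ {S : ℕ → Set} {f : ℕ → ℝ} (f-pos : ∀ k → S k → 0# < f k) where

    private
      Tail : ℕ → ℝ ± → Set
      Tail N z = ∃ λ k → N ℕ.≤ k × S k × z ≡ [ f k ]

      Small : ℕ → Set
      Small N = ∀ ε → 0# < ε → ∃ λ k → N ℕ.≤ k × S k × f k < ε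

      -- Since f is positive on S, values below f N are not attained at N.
      later : Small 0 → ∀ N → Small N
      later small ℕ.zero    = small
      later small (ℕ.suc N) ε 0<ε with em {S N}
      ... | no ¬SN with later small N ε 0<ε
      ...   | k , N≤k , Sk , fk<ε =
                k , ℕₚ.≤∧≢⇒< N≤k (λ N≡k → ¬SN (≡.subst S (≡.sym N≡k) Sk)) , Sk , fk<ε
      later small (ℕ.suc N) ε 0<ε | yes SN with positive-lowerBound 0<ε (f-pos N SN)
      ...   | δ , 0<δ , δ≤ε , δ≤fN with later small N δ 0<δ
      ...     | k , N≤k , Sk , fk<δ = k , ℕₚ.≤∧≢⇒< N≤k (λ { ≡.refl → <⇒≱ fk<δ δ≤fN }) , Sk ,
                  (begin-strict f k <⟨ fk<δ ⟩ δ ≤⟨ δ≤ε ⟩ ε ∎)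

      -- Stated for an arbitrary lower bound, so that the case split falls on a variable and not on
      -- a computed infimum. The value `⊤±` is excluded because every tail is inhabited.
      inf-Tail≤0 : Small 0 → ∀ N i → IsLowerBound _≤±_ (Tail N) i → i ≤± [ 0# ]
      inf-Tail≤0 small N ⊥±    _ = ≤±.⊥±≤ [ 0# ]
      inf-Tail≤0 small N [ x ] lb = ≤±.[ ≮⇒≥ (λ 0<x → case (later small N x 0<x)) ]
        where
        case : ∃ (λ k → N ℕ.≤ k × S k × f k < x) → _
        case (k , N≤k , Sk , fk<x) = <⇒≱ fk<x (≤±.[≤]-injective (lb [ f k ] (k , N≤k , Sk , ≡.refl)))
      inf-Tail≤0 small N ⊤±    lb with later small N 1# 0#<1#
      ... | k , N≤k , Sk , _ with lb [ f k ] (k , N≤k , Sk , ≡.refl)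
      ...   | ()

    -- If every term stayed at or above ε, so would the infimum of all terms, and the lower limit
    -- dominates that infimum.
    limInf≈0⇒small : limInf S f ≈± [ 0# ] → ∀ ε → 0# < ε → ∃ λ k → S k × f k < ε
    limInf≈0⇒small lim≈0 ε 0<ε with em {∃ λ k → S k × f k < ε}
    ... | yes small = small
    ... | no ¬small = ⊥-elim (<⇒≱ 0<ε (≤±.[≤]-injective
            (≤±-trans (≤±-trans ε≤inf inf≤lim) (≤±.≤±-reflexive ≤.reflexive lim≈0))))
      where
      ε≤inf : [ ε ] ≤± inf (Tail 0)
      ε≤inf = proj₂ (proj₂ (inf∃ (Tail 0))) [ ε ]
        λ { _ (k , _ , Sk , ≡.refl) → ≤±.[ ≮⇒≥ (λ fk<ε → ¬small (k , Sk , fk<ε)) ] }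
      inf≤lim : inf (Tail 0) ≤± limInf S f
      inf≤lim = proj₁ (proj₂ (sup∃ _)) (inf (Tail 0)) (0 , ≡.refl)

    -- Every tail still has arbitrarily small terms, so no tail infimum exceeds 0, while the infimum
    -- of all terms is already nonnegative.
    small⇒limInf≈0 : (∀ ε → 0# < ε → ∃ λ k → S k × f k < ε) → limInf S f ≈± [ 0# ]
    small⇒limInf≈0 small = ≤±.≤±-antisym ≤.antisym
      (proj₂ (proj₂ (sup∃ _)) [ 0# ]
        λ { _ (N , ≡.refl) → inf-Tail≤0 small₀ N (inf (Tail N)) (proj₁ (proj₂ (inf∃ (Tail N)))) })
      (≤±-trans 0≤inf (proj₁ (proj₂ (sup∃ _)) (inf (Tail 0)) (0 , ≡.refl)))
      where
      small₀ : Small 0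
      small₀ ε 0<ε with small ε 0<ε
      ... | k , Sk , fk<ε = k , ℕ.z≤n , Sk , fk<ε
      0≤inf : [ 0# ] ≤± inf (Tail 0)
      0≤inf = proj₂ (proj₂ (inf∃ (Tail 0))) [ 0# ]
        λ { _ (k , _ , Sk , ≡.refl) → ≤±.[ inj₁ (f-pos k Sk) ] }

  -- Powers

  open CommutativeExp commutativeSemiring using (^-assocʳ; ^-distrib-*)

  ^-nonNeg : ∀ {x} n → 0# ≤ x → 0# ≤ x ^ n
  ^-nonNeg ℕ.zero    _   = inj₁ 0#<1#
  ^-nonNeg (ℕ.suc n) 0≤x = *-nonNeg 0≤x (^-nonNeg n 0≤x)

  ^-pos : ∀ {x} n → 0# < x → 0# < x ^ n
  ^-pos ℕ.zero    _   = 0#<1#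
  ^-pos (ℕ.suc n) 0<x = *-pos 0<x (^-pos n 0<x)

  ^-monoˡ-≤ : ∀ {x y} n → 0# ≤ x → x ≤ y → x ^ n ≤ y ^ n
  ^-monoˡ-≤ ℕ.zero    _   _   = ≤.refl
  ^-monoˡ-≤ (ℕ.suc n) 0≤x x≤y =
    *-mono-≤ (^-nonNeg n 0≤x) (≤.trans 0≤x x≤y) x≤y (^-monoˡ-≤ n 0≤x x≤y)

  ^-monoˡ-< : ∀ {x y} n .{{_ : NonZero n}} → 0# ≤ x → x < y → x ^ n < y ^ n
  ^-monoˡ-< {x} {y} 1 0≤x x<y = begin-strict
    x * 1#  ≈⟨ *-identityʳ x ⟩
    x       <⟨ x<y ⟩
    y       ≈⟨ *-identityʳ y ⟨
    y * 1#  ∎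
  ^-monoˡ-< {x} {y} (ℕ.suc n@(ℕ.suc _)) 0≤x x<y = begin-strict
    x * x ^ n  ≤⟨ *-monoʳ-≤ (^-nonNeg n 0≤x) (inj₁ x<y) ⟩
    y * x ^ n  <⟨ *-monoˡ-< (≤-<-trans 0≤x x<y) (^-monoˡ-< n 0≤x x<y) ⟩
    y * y ^ n  ∎
    where
    ≤-<-trans : ∀ {x y z} → x ≤ y → y < z → x < z
    ≤-<-trans {x} {y} {z} x≤y y<z = begin-strict x ≤⟨ x≤y ⟩ y <⟨ y<z ⟩ z ∎

  ^-cancelˡ-≤ : ∀ {x y} n .{{_ : NonZero n}} → 0# ≤ y → x ^ n ≤ y ^ n → x ≤ y
  ^-cancelˡ-≤ n 0≤y xⁿ≤yⁿ = ≮⇒≥ (λ y<x → <⇒≱ (^-monoˡ-< n 0≤y y<x) xⁿ≤yⁿ)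

  1≤^ : ∀ {x} n → 1# ≤ x → 1# ≤ x ^ n
  1≤^     ℕ.zero    _   = ≤.refl
  1≤^ {x} (ℕ.suc n) 1≤x = begin
    1#         ≈⟨ *-identityˡ 1# ⟨
    1# * 1#    ≤⟨ *-mono-≤ (inj₁ 0#<1#) (≤.trans (inj₁ 0#<1#) 1≤x) 1≤x (1≤^ n 1≤x) ⟩
    x * x ^ n  ∎

  ^-monoʳ-≤ : ∀ {x m n} → 1# ≤ x → m ℕ.≤ n → x ^ m ≤ x ^ n
  ^-monoʳ-≤ {n = n} 1≤x ℕ.z≤n       = 1≤^ n 1≤x
  ^-monoʳ-≤         1≤x (ℕ.s≤s m≤n) = *-monoˡ-≤ (≤.trans (inj₁ 0#<1#) 1≤x) (^-monoʳ-≤ 1≤x m≤n)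

  module Power (β : ℝ) (1≤β : 1# ≤ β) where

    -- The set whose supremum is `k ^ᴿ β`, without the embedding into the extended reals.
    RationalPower≤ : ℕ → ℝ → Set
    RationalPower≤ k x = 0# ≤ x ×
      ∃ λ a → ∃ λ b → NonZero b × fromℕ a ≤ fromℕ b * β × x ^ b ≤ fromℕ k ^ a

    -- An integer exponent above β: `k ^ B` bounds the set that defines `k ^ᴿ β`, and `q ^ B` stands
    -- in for `q ^ᴿ β` in constants.
    B : ℕ
    B = proj₁ (archimedean β)

    β≤B : β ≤ fromℕ B
    β≤B = inj₁ (proj₂ (archimedean β))

    a≤b*B : ∀ a b → fromℕ a ≤ fromℕ b * β → a ℕ.≤ B ℕ.* b
    a≤b*B a b a≤bβ with a ℕₚ.≤? B ℕ.* b
    ... | yes a≤ = a≤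
    ... | no  a≰ = ⊥-elim (<⇒≱ B*b<a (begin
      fromℕ a            ≤⟨ a≤bβ ⟩
      fromℕ b * β        ≤⟨ *-monoˡ-≤ (fromℕ-nonNeg b) β≤B ⟩
      fromℕ b * fromℕ B  ≈⟨ *-comm (fromℕ b) (fromℕ B) ⟩
      fromℕ B * fromℕ b  ≈⟨ fromℕ-* B b ⟨
      fromℕ (B ℕ.* b)    ∎))
      where
      B*b<a : fromℕ (B ℕ.* b) < fromℕ a
      B*b<a = begin-strict
        fromℕ (B ℕ.* b)            <⟨ y≈x+d⇒x<y 0#<1# (+-comm 1# _) ⟩
        fromℕ (ℕ.suc (B ℕ.* b))    ≤⟨ fromℕ-mono-≤ (ℕₚ.≰⇒> a≰) ⟩
        fromℕ a                    ∎

    ^a≤^B^b : ∀ k a b → 1 ℕ.≤ k → fromℕ a ≤ fromℕ b * β → fromℕ k ^ a ≤ (fromℕ k ^ B) ^ b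
    ^a≤^B^b k a b 1≤k a≤bβ = begin
      fromℕ k ^ a          ≤⟨ ^-monoʳ-≤ {m = a} (1≤fromℕ 1≤k) (a≤b*B a b a≤bβ) ⟩
      fromℕ k ^ (B ℕ.* b)  ≈⟨ ^-assocʳ (fromℕ k) B b ⟨
      (fromℕ k ^ B) ^ b    ∎

    -- The exponent 1/1 is admissible because β is at least 1. This yields k ≤ k^β, by which a bound
    -- on k^β e becomes a bound on k e.
    k∈RationalPower≤ : ∀ k → RationalPower≤ k (fromℕ k)
    k∈RationalPower≤ k = fromℕ-nonNeg k , 1 , 1 , _ , (begin
      fromℕ 1      ≈⟨ fromℕ-1 ⟩
      1#           ≤⟨ 1≤β ⟩
      β            ≈⟨ *-identityˡ β ⟨
      1# * β       ≈⟨ *-congʳ fromℕ-1 ⟨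
      fromℕ 1 * β  ∎) , ≤.refl

    -- The set contains `fromℕ k` and is bounded by `fromℕ k ^ B`, so the extended supremum is a
    -- real number and `finite` merely unwraps it.
    ^ᴿ-isSup : ∀ k → 1 ℕ.≤ k → IsSup _≤_ (RationalPower≤ k) (k ^ᴿ β)
    ^ᴿ-isSup k 1≤k = isSup-finite (proj₁ (proj₂ (sup∃ P))) (proj₂ (proj₂ (sup∃ P)))
      where
      P : ℝ ± → Set
      P y = ∃ λ x → y ≡ [ x ] × RationalPower≤ k x
      bound : ∀ {x} → RationalPower≤ k x → x ≤ fromℕ k ^ B
      bound (_ , a , b , b≢0 , a≤bβ , xᵇ≤kᵃ) = ^-cancelˡ-≤ b {{b≢0}}
        (^-nonNeg B (fromℕ-nonNeg k)) (≤.trans xᵇ≤kᵃ (^a≤^B^b k a b 1≤k a≤bβ))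
      isSup-finite : ∀ {s} → IsUpperBound _≤±_ P s → (∀ u → IsUpperBound _≤±_ P u → s ≤± u) →
                     IsSup _≤_ (RationalPower≤ k) (finite s)
      isSup-finite {[ s ]} upper least =
        (λ x x∈ → ≤±.[≤]-injective (upper [ x ] (x , ≡.refl , x∈))) ,
        (λ u ub → ≤±.[≤]-injective (least [ u ] λ { _ (x , ≡.refl , x∈) → ≤±.[ ub x x∈ ] }))
      isSup-finite {⊥±} upper least with upper [ fromℕ k ] (fromℕ k , ≡.refl , k∈RationalPower≤ k)
      ... | Supremum.[ () ]
      isSup-finite {⊤±} upper least
        with least [ fromℕ k ^ B ] (λ { _ (x , ≡.refl , x∈) → ≤±.[ bound x∈ ] })
      ... | ()

    k≤k^ᴿβ : ∀ {k} → 1 ℕ.≤ k → fromℕ k ≤ k ^ᴿ β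
    k≤k^ᴿβ {k} 1≤k = proj₁ (^ᴿ-isSup k 1≤k) (fromℕ k) (k∈RationalPower≤ k)

    ^ᴿ-pos : ∀ {k} → 1 ℕ.≤ k → 0# < k ^ᴿ β
    ^ᴿ-pos {k} 1≤k = begin-strict
      0#       <⟨ fromℕ-pos 1≤k ⟩
      fromℕ k  ≤⟨ k≤k^ᴿβ 1≤k ⟩
      k ^ᴿ β   ∎

    ^ᴿ-mono-≤ : ∀ {k l} → 1 ℕ.≤ k → k ℕ.≤ l → k ^ᴿ β ≤ l ^ᴿ β
    ^ᴿ-mono-≤ {k} {l} 1≤k k≤l = proj₂ (^ᴿ-isSup k 1≤k) _
      λ x (0≤x , a , b , b≢0 , a≤bβ , xᵇ≤kᵃ) → proj₁ (^ᴿ-isSup l (ℕₚ.≤-trans 1≤k k≤l)) x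
        (0≤x , a , b , b≢0 , a≤bβ , ≤.trans xᵇ≤kᵃ (^-monoˡ-≤ a (fromℕ-nonNeg k) (fromℕ-mono-≤ k≤l)))

    -- If `x` is admissible for `q k` with exponent a/b, then `x` divided by `q ^ B` is admissible
    -- for `k` with the same exponent, because `a ≤ B b`.
    ^ᴿ-submultiplicative : ∀ {q k} → 1 ℕ.≤ q → 1 ℕ.≤ k → (q ℕ.* k) ^ᴿ β ≤ fromℕ q ^ B * k ^ᴿ β
    ^ᴿ-submultiplicative {q} {k} 1≤q 1≤k =
      proj₂ (^ᴿ-isSup (q ℕ.* k) (ℕₚ.*-mono-≤ 1≤q 1≤k)) _ bound
      where
      c = fromℕ q ^ B
      0<c = ^-pos B (fromℕ-pos 1≤q)
      bound : ∀ x → RationalPower≤ (q ℕ.* k) x → x ≤ c * k ^ᴿ β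
      bound x (0≤x , a , b , b≢0 , a≤bβ , xᵇ≤) = begin
        x            ≈⟨ cy≈x ⟨
        c * y        ≤⟨ *-monoˡ-≤ (inj₁ 0<c) (proj₁ (^ᴿ-isSup k 1≤k) y
                          (*-nonNeg (inj₁ (⁻¹-pos 0<c)) 0≤x , a , b , b≢0 , a≤bβ , yᵇ≤kᵃ)) ⟩
        c * k ^ᴿ β   ∎
        where
        y = c ⁻¹ * x
        cy≈x : c * y ≈ x
        cy≈x = trans (sym (*-assoc c (c ⁻¹) x)) (trans (*-congʳ (*-inverseʳ
                 (λ c≈0 → <.irrefl (sym c≈0) 0<c))) (*-identityˡ x))
        yᵇ≤kᵃ : y ^ b ≤ fromℕ k ^ a
        yᵇ≤kᵃ = *-cancelˡ-≤ (^-pos b 0<c) (begin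
          c ^ b * y ^ b              ≈⟨ ^-distrib-* c y b ⟨
          (c * y) ^ b                ≈⟨ CommutativeExp.^-congˡ commutativeSemiring b cy≈x ⟩
          x ^ b                      ≤⟨ xᵇ≤ ⟩
          fromℕ (q ℕ.* k) ^ a        ≈⟨ CommutativeExp.^-congˡ commutativeSemiring a (fromℕ-* q k) ⟩
          (fromℕ q * fromℕ k) ^ a    ≈⟨ ^-distrib-* (fromℕ q) (fromℕ k) a ⟩
          fromℕ q ^ a * fromℕ k ^ a  ≤⟨ *-monoʳ-≤ (^-nonNeg a (fromℕ-nonNeg k)) (^a≤^B^b q a b 1≤q a≤bβ) ⟩
          c ^ b * fromℕ k ^ a        ∎)

  -- Continued fractions

  module ContinuedFraction (α : ℝ) (α-irrational : Irrational α) where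

    q : ℕ → ℕ
    q = denominator α

    a : ℕ → ℕ
    a n = ∣ partialQuotient α n ∣

    p : ℕ → ℤ
    p 0                   = partialQuotient α 0
    p 1                   = p 0 ℤ.* + a 1 ℤ.+ + 1
    p (ℕ.suc (ℕ.suc n))   = + a (ℕ.suc (ℕ.suc n)) ℤ.* p (ℕ.suc n) ℤ.+ p n

    -- The fractional part of the complete quotient; its inverse is the next complete quotient, and
    -- the product of θ 0, ..., θ n is the distance `E n`.
    θ : ℕ → ℝ
    θ n = completeQuotient α n - fromℤ (partialQuotient α n)

    -- The distance of q n * α to the integer p n.
    E : ℕ → ℝ
    E ℕ.zero    = θ 0
    E (ℕ.suc n) = θ (ℕ.suc n) * E n

    δ : ℕ → ℝ
    δ n = fromℕ (q n) * α - fromℤ (p n)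

    θ-nonNeg : ∀ n → 0# ≤ θ n
    θ-nonNeg n = x≤y⇒0≤y-x (proj₁ (proj₂ (floor∃ (completeQuotient α n))))

    θ<1 : ∀ n → θ n < 1#
    θ<1 n = y≈x+d⇒x<y (x<y⇒0<y-x (proj₂ (proj₂ (floor∃ x))))
      (solve 3 (λ x i u → u := (x :- i) :+ ((i :+ u) :- x)) refl x (fromℤ ⌊ x ⌋) 1#)
      where x = completeQuotient α n

    -- The inverse of a number in (0, 1) exceeds 1, so its floor is positive and the absolute value
    -- in `a` changes nothing. The equation is θ_n (a_{n+1} + θ_{n+1}) = 1, freed of inverses for
    -- the ring solver.
    0<θ⇒1≤a : ∀ n → 0# < θ n →
              1 ℕ.≤ a (ℕ.suc n) × fromℕ (a (ℕ.suc n)) * θ n + θ (ℕ.suc n) * θ n ≈ 1#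
    0<θ⇒1≤a n 0<θ = proj₂ positive , (begin-equality
      fromℕ (a (ℕ.suc n)) * θ n + (x - fromℤ i) * θ n
          ≈⟨ +-congʳ (*-congʳ (reflexive (≡.cong fromℤ (proj₁ positive)))) ⟩
      fromℤ i * θ n + (x - fromℤ i) * θ n  ≈⟨ solve 3 (λ i t x → i :* t :+ (x :- i) :* t := t :* x)
            refl (fromℤ i) (θ n) x ⟩
      θ n * x                              ≈⟨ θx≈1 ⟩
      1#                                   ∎)
      where
      x = θ n ⁻¹
      i = partialQuotient α (ℕ.suc n)
      θx≈1 : θ n * x ≈ 1#
      θx≈1 = *-inverseʳ (λ θ≈0 → <.irrefl (sym θ≈0) 0<θ)
      1<x : 1# < x
      1<x = *-cancelˡ-< (inj₁ 0<θ)
        (<.<-respˡ-≈ (sym (*-identityʳ (θ n))) (<.<-respʳ-≈ (sym θx≈1) (θ<1 n)))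
      positive : + ∣ i ∣ ≡ i × 1 ℕ.≤ ∣ i ∣
      positive = fromℤ-pos⁻ i (<.<-respʳ-≈
        (solve 2 (λ i u → (i :+ u) :- u := i) refl (fromℤ i) 1#)
        (x<y⇒0<y-x (<.trans 1<x (proj₂ (proj₂ (floor∃ x))))))

    δ≉0 : ∀ n → 1 ℕ.≤ q n → ¬ δ n ≈ 0#
    δ≉0 n 1≤q δ≈0 = α-irrational (p n) (q n) {{ℕ.>-nonZero 1≤q}} (begin-equality
      α                ≈⟨ modulo (- α) (*-inverseʳ Q≉0)
                            (solve 3 (λ x Q R → x := x :* (Q :* R) :+ :- x :* (Q :* R :- con (+ 1)))
                                  refl α Q (Q ⁻¹)) ⟩
      α * (Q * Q ⁻¹)   ≈⟨ modulo (Q ⁻¹) δ≈0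
                            (solve 4 (λ x Q R P → x :* (Q :* R) := P :* R :+ R :* ((Q :* x :- P) :- con (+ 0)))
                              refl α Q (Q ⁻¹) (fromℤ (p n))) ⟩
      fromℤ (p n) * Q ⁻¹  ∎)
      where
      Q = fromℕ (q n)
      Q≉0 : ¬ Q ≈ 0#
      Q≉0 Q≈0 = <.irrefl (sym Q≈0) (fromℕ-pos 1≤q)

    -- These facts must be carried through one induction: the formula for `δ n` and irrationality
    -- force `θ n` to be nonzero, and a positive `θ n` makes the next partial quotient positive.
    record Convergent (n : ℕ) : Set where
      field
        θ-pos : 0# < θ n
        E-pos : 0# < E n
        q-pos : 1 ℕ.≤ q n
        δ≈    : δ n ≈ sgn (parity n) * E n

    -- If `θ n` vanished, so would `E n` and hence `δ n`, making α rational. The factor `e` is 1 at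
    -- index 0 and the preceding `E` afterwards, which lets all indices share the argument.
    convergent : ∀ n {e} → 0# < e → E n ≈ θ n * e → 1 ℕ.≤ q n → δ n ≈ sgn (parity n) * E n →
                 Convergent n
    convergent n {e} 0<e E≈ 1≤q δ≈ = record
      { θ-pos = 0<θ ; E-pos = <.<-respʳ-≈ (sym E≈) (*-pos 0<θ 0<e) ; q-pos = 1≤q ; δ≈ = δ≈ }
      where
      0<θ : 0# < θ n
      0<θ = ≤∧≉⇒< (θ-nonNeg n) λ 0≈θ → δ≉0 n 1≤q (begin-equality
        δ n                           ≈⟨ δ≈ ⟩
        sgn (parity n) * E n          ≈⟨ *-congˡ E≈ ⟩
        sgn (parity n) * (θ n * e)    ≈⟨ *-congˡ (*-congʳ 0≈θ) ⟨
        sgn (parity n) * (0# * e)     ≈⟨ solve 2 (λ s e → s :* (con (+ 0) :* e) := con (+ 0))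
              refl (sgn (parity n)) e ⟩
        0#                            ∎)

    convergent₀ : Convergent 0
    convergent₀ = convergent 0 0#<1# (sym (*-identityʳ (θ 0))) ℕₚ.≤-refl
      (begin-equality
        fromℕ 1 * α - P  ≈⟨ +-congʳ (*-congʳ fromℕ-1) ⟩
        1# * α - P       ≈⟨ solve 2 (λ x P → con (+ 1) :* x :- P := con (+ 1) :* (x :- P)) refl α P ⟩
        1# * (α - P)     ∎)
      where P = fromℤ (p 0)

    convergent₁ : Convergent 1
    convergent₁ = convergent 1 E-pos refl (proj₁ next) (begin-equality
      A * α - fromℤ (p 1)    ≈⟨ +-congˡ (-‿cong (trans (fromℤ-+ (p 0 ℤ.* + a 1) (+ 1))
                                  (+-cong (fromℤ-* (p 0) (+ a 1)) fromℕ-1))) ⟩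
      A * α - (P * A + 1#)   ≈⟨ modulo 1# (proj₂ next) (solve 4 (λ A x P t →
                                  A :* x :- (P :* A :+ con (+ 1)) := :- con (+ 1) :* (t :* (x :- P)) :+
                                  con (+ 1) :* ((A :* (x :- P) :+ t :* (x :- P)) :- con (+ 1))) refl A α P (θ 1)) ⟩
      - 1# * (θ 1 * θ 0)     ∎)
      where
      open Convergent convergent₀
      A = fromℕ (a 1)
      P = fromℤ (p 0)
      next = 0<θ⇒1≤a 0 θ-pos

    fromℕ-q : ∀ n → fromℕ (q (ℕ.suc (ℕ.suc n))) ≈
                    fromℕ (a (ℕ.suc (ℕ.suc n))) * fromℕ (q (ℕ.suc n)) + fromℕ (q n)
    fromℕ-q n = trans (fromℕ-+ (a (ℕ.suc (ℕ.suc n)) ℕ.* q (ℕ.suc n)) (q n))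
                      (+-congʳ (fromℕ-* (a (ℕ.suc (ℕ.suc n))) (q (ℕ.suc n))))

    fromℤ-p : ∀ n → fromℤ (p (ℕ.suc (ℕ.suc n))) ≈
                    fromℕ (a (ℕ.suc (ℕ.suc n))) * fromℤ (p (ℕ.suc n)) + fromℤ (p n)
    fromℤ-p n = trans (fromℤ-+ (+ a (ℕ.suc (ℕ.suc n)) ℤ.* p (ℕ.suc n)) (p n))
                      (+-congʳ (fromℤ-* (+ a (ℕ.suc (ℕ.suc n))) (p (ℕ.suc n))))

    convergent₊ : ∀ n → Convergent n → Convergent (ℕ.suc n) → Convergent (ℕ.suc (ℕ.suc n))
    convergent₊ n c₀ c₁ = convergent (ℕ.suc (ℕ.suc n)) C₁.E-pos refl
      (ℕₚ.≤-trans C₀.q-pos (ℕₚ.m≤n+m _ _)) (begin-equality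
      fromℕ (q (ℕ.suc (ℕ.suc n))) * α - fromℤ (p (ℕ.suc (ℕ.suc n)))
        ≈⟨ +-cong (*-congʳ (fromℕ-q n)) (-‿cong (fromℤ-p n)) ⟩
      (A * Q₁ + Q₀) * α - (A * P₁ + P₀)
        ≈⟨ solve 6 (λ A Q₁ Q₀ x P₁ P₀ → (A :* Q₁ :+ Q₀) :* x :- (A :* P₁ :+ P₀) :=
             A :* (Q₁ :* x :- P₁) :+ (Q₀ :* x :- P₀)) refl A Q₁ Q₀ α P₁ P₀ ⟩
      A * δ (ℕ.suc n) + δ n
        ≈⟨ +-cong (*-congˡ (trans C₁.δ≈ (*-congʳ (sgn-opposite (parity n))))) C₀.δ≈ ⟩
      A * (- s * (t₁ * E n)) + s * E n
        -- The equation of `next` times `E n` says that `E n` is `A` times `E (n + 1)` plus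
        -- `E (n + 2)`.
        ≈⟨ modulo (- s * E n) (proj₂ next) (solve 5 (λ A s t₁ t₂ e →
             A :* (:- s :* (t₁ :* e)) :+ s :* e := s :* (t₂ :* (t₁ :* e)) :+
             (:- s :* e) :* ((A :* t₁ :+ t₂ :* t₁) :- con (+ 1))) refl A s t₁ t₂ (E n)) ⟩
      s * (t₂ * (t₁ * E n))
        ≈⟨ *-congʳ (reflexive (≡.cong sgn (opposite-involutive (parity n)))) ⟨
      sgn (parity (ℕ.suc (ℕ.suc n))) * (t₂ * (t₁ * E n)) ∎)
      where
      module C₀ = Convergent c₀
      module C₁ = Convergent c₁
      A = fromℕ (a (ℕ.suc (ℕ.suc n)))
      Q₀ = fromℕ (q n)
      Q₁ = fromℕ (q (ℕ.suc n))
      P₀ = fromℤ (p n)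
      P₁ = fromℤ (p (ℕ.suc n))
      s = sgn (parity n)
      t₁ = θ (ℕ.suc n)
      t₂ = θ (ℕ.suc (ℕ.suc n))
      next = 0<θ⇒1≤a (ℕ.suc n) C₁.θ-pos

    convergents : ∀ n → Convergent n × Convergent (ℕ.suc n)
    convergents ℕ.zero    = convergent₀ , convergent₁
    convergents (ℕ.suc n) with convergents n
    ... | c₀ , c₁ = c₁ , convergent₊ n c₀ c₁

    private module C n = Convergent (proj₁ (convergents n))
    open C public

    1≤a : ∀ n → 1 ℕ.≤ a (ℕ.suc n)
    1≤a n = proj₁ (0<θ⇒1≤a n (θ-pos n))

    q₊+q≤q₊₊ : ∀ n → q (ℕ.suc n) ℕ.+ q n ℕ.≤ q (ℕ.suc (ℕ.suc n))
    q₊+q≤q₊₊ n = ℕₚ.+-monoˡ-≤ (q n)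
      (ℕₚ.m≤n*m (q (ℕ.suc n)) (a (ℕ.suc (ℕ.suc n))) {{ℕ.>-nonZero (1≤a (ℕ.suc n))}})

    -- Makes the denominators unbounded, so that a crossing index exists, and gives `q (n + 1) ≥ 2`
    -- as soon as n ≥ 1.
    n<q₊ : ∀ n → n ℕ.< q (ℕ.suc n)
    n<q₊ ℕ.zero    = q-pos 1
    n<q₊ (ℕ.suc n) = ℕₚ.≤-trans (ℕₚ.≤-reflexive (≡.sym (ℕₚ.+-comm (ℕ.suc n) 1)))
      (ℕₚ.≤-trans (ℕₚ.+-mono-≤ (n<q₊ n) (q-pos n)) (q₊+q≤q₊₊ n))

    -- The absolute value of the determinant of two consecutive convergents: q_{n+1} δ_n - q_n
    -- δ_{n+1} is ±1, and the alternating signs of δ turn the difference into a sum.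
    q₊E+qE₊≈1 : ∀ n → fromℕ (q (ℕ.suc n)) * E n + fromℕ (q n) * E (ℕ.suc n) ≈ 1#
    q₊E+qE₊≈1 ℕ.zero = begin-equality
      A * θ 0 + fromℕ 1 * (θ 1 * θ 0)  ≈⟨ +-congˡ (trans (*-congʳ fromℕ-1) (*-identityˡ _)) ⟩
      A * θ 0 + θ 1 * θ 0              ≈⟨ proj₂ (0<θ⇒1≤a 0 (θ-pos 0)) ⟩
      1#                               ∎
      where A = fromℕ (a 1)
    q₊E+qE₊≈1 (ℕ.suc n) = begin-equality
      fromℕ (q (ℕ.suc (ℕ.suc n))) * (t₁ * E n) + Q₁ * (t₂ * (t₁ * E n))
        ≈⟨ +-congʳ (*-congʳ (fromℕ-q n)) ⟩
      (A * Q₁ + Q₀) * (t₁ * E n) + Q₁ * (t₂ * (t₁ * E n))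
        ≈⟨ modulo (Q₁ * E n) (proj₂ (0<θ⇒1≤a (ℕ.suc n) (θ-pos (ℕ.suc n)))) (solve 6 (λ A Q₁ Q₀ t₁ t₂ e →
             (A :* Q₁ :+ Q₀) :* (t₁ :* e) :+ Q₁ :* (t₂ :* (t₁ :* e)) :=
             (Q₁ :* e :+ Q₀ :* (t₁ :* e)) :+ (Q₁ :* e) :* ((A :* t₁ :+ t₂ :* t₁) :- con (+ 1)))
             refl A Q₁ Q₀ t₁ t₂ (E n)) ⟩
      Q₁ * E n + Q₀ * (t₁ * E n)
        ≈⟨ q₊E+qE₊≈1 n ⟩
      1# ∎
      where
      A = fromℕ (a (ℕ.suc (ℕ.suc n)))
      Q₀ = fromℕ (q n)
      Q₁ = fromℕ (q (ℕ.suc n))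
      t₁ = θ (ℕ.suc n)
      t₂ = θ (ℕ.suc (ℕ.suc n))

    q₊E<1 : ∀ n → fromℕ (q (ℕ.suc n)) * E n < 1#
    q₊E<1 n = y≈x+d⇒x<y (*-pos (fromℕ-pos (q-pos n)) (E-pos (ℕ.suc n))) (sym (q₊E+qE₊≈1 n))

    -- From n = 1 on the following denominator is at least 2. At n = 0 it may be 1, and `E 0` may
    -- exceed ½.
    2E<1 : ∀ {n} → 1 ℕ.≤ n → E n + E n < 1#
    2E<1 {n} 1≤n = begin-strict
      E n + E n                  ≈⟨ solve 1 (λ e → e :+ e := (con (+ 1) :+ (con (+ 1) :+ con (+ 0))) :* e)
            refl (E n) ⟩
      fromℕ 2 * E n              ≤⟨ *-monoʳ-≤ (inj₁ (E-pos n)) (fromℕ-mono-≤ (ℕₚ.≤-trans (ℕ.s≤s 1≤n) (n<q₊ n))) ⟩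
      fromℕ (q (ℕ.suc n)) * E n  <⟨ q₊E<1 n ⟩
      1#                         ∎

    signedFrac-qα : ∀ {n} → 1 ℕ.≤ n → signedFrac (fromℕ (q n) * α) ≈ sgn (parity n) * E n
    signedFrac-qα {n} 1≤n = signedFrac-sgn (parity n) (p n) (begin-equality
      fromℕ (q n) * α - sgn (parity n) * E n  ≈⟨ +-congˡ (-‿cong (δ≈ n)) ⟨
      fromℕ (q n) * α - δ n                   ≈⟨ solve 2 (λ x P → x :- (x :- P) := P)
            refl (fromℕ (q n) * α) (fromℤ (p n)) ⟩
      fromℤ (p n)                             ∎) (E-pos n) (2E<1 1≤n)

    -- Determinants, coprimality and Legendre's criterion

    +q : ∀ n → + q (ℕ.suc (ℕ.suc n)) ≡ + a (ℕ.suc (ℕ.suc n)) ℤ.* + q (ℕ.suc n) ℤ.+ + q n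
    +q n = ≡.cong (ℤ._+ + q n) (ℤₚ.pos-* (a (ℕ.suc (ℕ.suc n))) (q (ℕ.suc n)))

    determinant : ℕ → ℤ
    determinant n = p (ℕ.suc n) ℤ.* + q n ℤ.- p n ℤ.* + q (ℕ.suc n)

    determinant-suc : ∀ n → determinant (ℕ.suc n) ≡ ℤ.- determinant n
    determinant-suc n = ≡.trans
      (≡.cong (λ x → p (ℕ.suc (ℕ.suc n)) ℤ.* + q (ℕ.suc n) ℤ.- p (ℕ.suc n) ℤ.* x) (+q n))
      (identity (+ a (ℕ.suc (ℕ.suc n))) (p n) (p (ℕ.suc n)) (+ q n) (+ q (ℕ.suc n)))
      where
      identity : ∀ A P₀ P₁ Q₀ Q₁ → (A ℤ.* P₁ ℤ.+ P₀) ℤ.* Q₁ ℤ.- P₁ ℤ.* (A ℤ.* Q₁ ℤ.+ Q₀) ≡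
                                   ℤ.- (P₁ ℤ.* Q₀ ℤ.- P₀ ℤ.* Q₁)
      identity = ℤ-solve-∀

    -- Invertibility is what coprimality calls for, so the alternating sign is carried as a witness
    -- ε and no parity case arises.
    determinant-unit : ∀ n → ∃ λ ε → ε ℤ.* determinant n ≡ + 1
    determinant-unit ℕ.zero = + 1 , identity (p 0) (+ a 1)
      where
      identity : ∀ P A → + 1 ℤ.* ((P ℤ.* A ℤ.+ + 1) ℤ.* + 1 ℤ.- P ℤ.* A) ≡ + 1
      identity = ℤ-solve-∀
    determinant-unit (ℕ.suc n) with determinant-unit n
    ... | ε , εD≡1 = ℤ.- ε , ≡.trans (≡.cong (ℤ.- ε ℤ.*_) (determinant-suc n))
                               (≡.trans (identity ε (determinant n)) εD≡1)
      where
      identity : ∀ ε D → ℤ.- ε ℤ.* ℤ.- D ≡ ε ℤ.* D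
      identity = ℤ-solve-∀

    bezout : ∀ n → ∃ λ u → ∃ λ v → u ℤ.* p n ℤ.+ v ℤ.* + q n ≡ + 1
    bezout n with determinant-unit n
    ... | ε , εD≡1 = ℤ.- ε ℤ.* + q (ℕ.suc n) , ε ℤ.* p (ℕ.suc n) ,
      ≡.trans (identity ε (p n) (p (ℕ.suc n)) (+ q n) (+ q (ℕ.suc n))) εD≡1
      where
      identity : ∀ ε P₀ P₁ Q₀ Q₁ → ℤ.- ε ℤ.* Q₁ ℤ.* P₀ ℤ.+ ε ℤ.* P₁ ℤ.* Q₀ ≡
                                   ε ℤ.* (P₁ ℤ.* Q₀ ℤ.- P₀ ℤ.* Q₁)
      identity = ℤ-solve-∀

    q-coprime-p : ∀ n → Coprime (+ q n) (p n)
    q-coprime-p n (d∣q , d∣p) with bezout n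
    ... | u , v , eq = ℕ∣.∣1⇒≡1 (ℤ∣.∣⇒∣ᵤ {+ _} {+ 1} (≡.subst (ℤ∣._∣_ (+ _)) eq
      (ℤ∣.∣m∣n⇒∣m+n (ℤ∣.∣n⇒∣m*n u (ℤ∣.∣ᵤ⇒∣ {+ _} d∣p)) (ℤ∣.∣n⇒∣m*n v (ℤ∣.∣ᵤ⇒∣ {+ _} d∣q)))))

    -- Descent from an index whose denominator exceeds `N`; it stops at the latest at index 0,
    -- because `q 0 = 1 ≤ N`.
    q-crossing : ∀ N m → 1 ℕ.≤ N → N ℕ.< q m → ∃ λ j → q j ℕ.≤ N × N ℕ.< q (ℕ.suc j)
    q-crossing N ℕ.zero    1≤N N<q = ⊥-elim (ℕₚ.<⇒≱ N<q 1≤N)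
    q-crossing N (ℕ.suc m) 1≤N N<q with q m ℕₚ.≤? N
    ... | yes q≤N = m , q≤N , N<q
    ... | no  q≰N = q-crossing N m 1≤N (ℕₚ.≰⇒> q≰N)

    -- A weak form of Legendre's theorem.  If q j ≤ 2K < q (j + 1), then the
    -- integer M q j − K p j = K δ j − q j (K α − M) is less than 1 in absolute value.
    legendre : ∀ σ K M {τ} → 1 ℕ.≤ K → 0# < τ → fromℕ K * α - fromℤ M ≈ sgn σ * τ →
               fromℕ 4 * (fromℕ K * τ) < 1# →
               ∃ λ j → parity j ≡ σ × M ℤ.* + q j ≡ + K ℤ.* p j × fromℕ K * E j ≈ fromℕ (q j) * τ
    legendre σ K M {τ} 1≤K 0<τ Kα-M≈ 4Kτ<1
      with q-crossing (K ℕ.+ K) (ℕ.suc (K ℕ.+ K)) (ℕₚ.≤-trans 1≤K (ℕₚ.m≤m+n K K)) (n<q₊ (K ℕ.+ K))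
    ... | j , q≤2K , 2K<q₊ = j , result (same-or-opposite (parity j) σ)
      where
      k = fromℕ K
      Q = fromℕ (q j)
      W = M ℤ.* + q j ℤ.- + K ℤ.* p j
      X = k * E j
      Y = Q * τ
      0<X : 0# < X
      0<X = *-pos (fromℕ-pos 1≤K) (E-pos j)
      0<Y : 0# < Y
      0<Y = *-pos (fromℕ-pos (q-pos j)) 0<τ
      -- `2K < q (j + 1)` together with `q (j + 1) E j < 1` gives 2X < 1; the crossing is taken at
      -- 2K for this purpose.
      X<½ : X < ½
      X<½ = <½ (begin-strict
        k * E j + k * E j          ≈⟨ distribʳ (E j) k k ⟨
        (k + k) * E j              ≈⟨ *-congʳ (fromℕ-+ K K) ⟨
        fromℕ (K ℕ.+ K) * E j      ≤⟨ *-monoʳ-≤ (inj₁ (E-pos j)) (fromℕ-mono-≤ (ℕₚ.<⇒≤ 2K<q₊)) ⟩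
        fromℕ (q (ℕ.suc j)) * E j  <⟨ q₊E<1 j ⟩
        1#                         ∎)
      Y≤ : Y ≤ (k + k) * τ
      Y≤ = begin
        Q * τ                ≤⟨ *-monoʳ-≤ (inj₁ 0<τ) (fromℕ-mono-≤ q≤2K) ⟩
        fromℕ (K ℕ.+ K) * τ  ≈⟨ *-congʳ (fromℕ-+ K K) ⟩
        (k + k) * τ          ∎
      -- `q j ≤ 2K` costs one factor 2 and the bound ½ another, whence the 4 in the hypothesis.
      Y<½ : Y < ½
      Y<½ = begin-strict
        Y            ≤⟨ Y≤ ⟩
        (k + k) * τ  <⟨ <½ (<.<-respˡ-≈ (solve 2 (λ k t →
                          (con (+ 1) :+ (con (+ 1) :+ (con (+ 1) :+ (con (+ 1) :+ con (+ 0))))) :* (k :* t) :=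
                          (k :+ k) :* t :+ (k :+ k) :* t) refl k τ) 4Kτ<1) ⟩
        ½            ∎
      W≈ : ∀ {s} → sgn (parity j) ≈ s → fromℤ W ≈ s * X - sgn σ * Y
      W≈ {s} sgn≈ = begin-equality
        fromℤ W
          ≈⟨ fromℤ-+ (M ℤ.* + q j) (ℤ.- (+ K ℤ.* p j)) ⟩
        fromℤ (M ℤ.* + q j) + fromℤ (ℤ.- (+ K ℤ.* p j))
          ≈⟨ +-cong (fromℤ-* M (+ q j)) (trans (fromℤ-neg (+ K ℤ.* p j)) (-‿cong (fromℤ-* (+ K) (p j)))) ⟩
        fromℤ M * Q - k * fromℤ (p j)
          ≈⟨ solve 5 (λ m Q k P x → m :* Q :- k :* P := k :* (Q :* x :- P) :- Q :* (k :* x :- m))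
               refl (fromℤ M) Q k (fromℤ (p j)) α ⟩
        k * δ j - Q * (k * α - fromℤ M)
          ≈⟨ +-cong (*-congˡ (trans (δ≈ j) (*-congʳ sgn≈))) (-‿cong (*-congˡ Kα-M≈)) ⟩
        k * (s * E j) - Q * (sgn σ * τ)
          ≈⟨ solve 6 (λ k s e Q u t → k :* (s :* e) :- Q :* (u :* t) := s :* (k :* e) :- u :* (Q :* t))
               refl k s (E j) Q (sgn σ) τ ⟩
        s * X - sgn σ * Y ∎
      -1<0 : - 1# < 0#
      -1<0 = <.<-respʳ-≈ -0#≈0# (neg-mono-< 0#<1#)
      ½<1 : ½ < 1#
      ½<1 = y≈x+d⇒x<y 0<½ (sym ½+½≈1)
      result : parity j ≡ σ ⊎ parity j ≡ Sign.opposite σ →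
               parity j ≡ σ × M ℤ.* + q j ≡ + K ℤ.* p j × X ≈ Y
      -- With equal signs `W` is ±(X - Y), so `W = 0` yields both the integer equation and X = Y.
      result (inj₁ par≡σ) = par≡σ , ℤₚ.i-j≡0⇒i≡j _ _ (proj₁ zero-diff) ,
        modulo 1# (proj₂ zero-diff) (solve 2 (λ X Y → X := Y :+ con (+ 1) :* ((X :- Y) :- con (+ 0))) refl X Y)
        where
        zero-diff : W ≡ + 0 × X - Y ≈ 0#
        zero-diff = sgn-integer σ W
          (trans (W≈ (reflexive (≡.cong sgn par≡σ)))
            (solve 3 (λ s X Y → s :* X :- s :* Y := s :* (X :- Y)) refl (sgn σ) X Y))
          (begin-strict
            - 1#    <⟨ neg-mono-< (<.trans Y<½ ½<1) ⟩
            - Y     <⟨ y≈x+d⇒x<y 0<X (+-comm X (- Y)) ⟩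
            X - Y   ∎)
          (begin-strict
            X - Y   <⟨ y≈x+d⇒x<y 0<Y (solve 2 (λ X Y → X := (X :- Y) :+ Y) refl X Y) ⟩
            X       <⟨ <.trans X<½ ½<1 ⟩
            1#      ∎)
      -- With opposite signs `W` is ±(X + Y), and 0 < X + Y < 1 leaves no room for an integer.
      result (inj₂ par≡-σ) = ⊥-elim (<.irrefl (sym (proj₂ zero-sum)) (+-pos 0<X 0<Y))
        where
        zero-sum : W ≡ + 0 × X + Y ≈ 0#
        zero-sum = sgn-integer (parity j) W
          (trans (W≈ refl)
            (modulo (- Y) (trans (reflexive (≡.cong sgn par≡-σ)) (sgn-opposite σ))
              (solve 4 (λ u s X Y → s :* X :- u :* Y := s :* (X :+ Y) :+ (:- Y) :* (s :- :- u))
                refl (sgn σ) (sgn (parity j)) X Y)))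
          (<.trans -1<0 (+-pos 0<X 0<Y))
          (<.<-respʳ-≈ ½+½≈1 (+-mono-< X<½ Y<½))

    -- Approximations to a rational shift and divisible denominators

    module Rational (c : ℤ) (d : ℕ) .{{_ : NonZero d}} (c-coprime-d : Coprime c (+ d)) where

      ρ : ℝ
      ρ = c /ᴿ d

      1≤d : 1 ℕ.≤ d
      1≤d = ℕ.>-nonZero⁻¹ d

      dρ≈c : fromℕ d * ρ ≈ fromℤ c
      dρ≈c = modulo (fromℤ c) (*-inverseʳ (λ d≈0 → <.irrefl (sym d≈0) (fromℕ-pos 1≤d)))
        (solve 3 (λ D C R → D :* (C :* R) := C :+ C :* (D :* R :- con (+ 1)))
              refl (fromℕ d) (fromℤ c) (fromℕ d ⁻¹))

      d-coprime-c+dm : ∀ m → Coprime (+ d) (c ℤ.+ m ℤ.* + d)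
      d-coprime-c+dm m {i} (i∣d , i∣c+md) = c-coprime-d (ℤ∣.∣⇒∣ᵤ {+ i} {c}
        (ℤ∣.∣m+n∣n⇒∣m {+ i} {c} {m ℤ.* + d} (ℤ∣.∣ᵤ⇒∣ i∣c+md) (ℤ∣.∣n⇒∣m*n m (ℤ∣.∣ᵤ⇒∣ {+ i} {+ d} i∣d))) , i∣d)

      -- The last hypothesis is the smallness condition of `legendre` for `K = d k` and distance
      -- `d e`, the values left after clearing the denominator of ρ.
      approximation⇒denominator : ∀ σ k {e} → 1 ℕ.≤ k → 0# < e →
        signedFrac (fromℕ k * α - ρ) ≈ sgn σ * e → fromℕ 4 * (fromℕ (d ℕ.* k) * (fromℕ d * e)) < 1# →
        ∃ λ j → parity j ≡ σ × d ∣ q j × q j ℕ.≤ d ℕ.* k × E j ≤ fromℕ d * e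
      approximation⇒denominator σ k {e} 1≤k 0<e s≈ small = conclude
        (legendre σ K M 1≤K (*-pos (fromℕ-pos 1≤d) 0<e) Kα-M≈ small)
        where
        K = d ℕ.* k
        x = fromℕ k * α - ρ
        s = signedFrac x
        m = proj₁ (proj₂ (proj₂ (signedFrac∃ x)))
        x-s≈m : x - s ≈ fromℤ m
        x-s≈m = proj₂ (proj₂ (proj₂ (signedFrac∃ x)))
        M = c ℤ.+ m ℤ.* + d
        D = fromℕ d
        1≤K : 1 ℕ.≤ K
        1≤K = ℕₚ.*-mono-≤ 1≤d 1≤k
        Kα-M≈ : fromℕ K * α - fromℤ M ≈ sgn σ * (D * e)
        Kα-M≈ = begin-equality
          fromℕ K * α - fromℤ M
            ≈⟨ +-cong (*-congʳ (fromℕ-* d k)) (-‿cong (trans (fromℤ-+ c (m ℤ.* + d)) (+-congˡ (fromℤ-* m (+ d))))) ⟩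
          D * fromℕ k * α - (fromℤ c + fromℤ m * D)
            ≈⟨ modulo 1# dρ≈c (solve 6 (λ D k x C m r → D :* k :* x :- (C :+ m :* D) :=
                 D :* ((k :* x :- r) :- m) :+ con (+ 1) :* (D :* r :- C))
                       refl D (fromℕ k) α (fromℤ c) (fromℤ m) ρ) ⟩
          D * (x - fromℤ m)
            ≈⟨ modulo D x-s≈m (solve 4 (λ D x m s → D :* (x :- m) := D :* s :+ D :* ((x :- s) :- m))
                 refl D x (fromℤ m) s) ⟩
          D * s
            ≈⟨ *-congˡ s≈ ⟩
          D * (sgn σ * e)
            ≈⟨ solve 3 (λ D u e → D :* (u :* e) := u :* (D :* e)) refl D (sgn σ) e ⟩
          sgn σ * (D * e) ∎
        conclude : (∃ λ j → parity j ≡ σ × M ℤ.* + q j ≡ + K ℤ.* p j × fromℕ K * E j ≈ fromℕ (q j) * (D * e)) →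
                   ∃ λ j → parity j ≡ σ × d ∣ q j × q j ℕ.≤ K × E j ≤ D * e
        conclude (j , par , Mq≡Kp , KE≈) = j , par , d∣q , q≤K , *-cancelˡ-≤ (fromℕ-pos 1≤K) (begin
          fromℕ K * E j          ≈⟨ KE≈ ⟩
          fromℕ (q j) * (D * e)  ≤⟨ *-monoʳ-≤ (inj₁ (*-pos (fromℕ-pos 1≤d) 0<e)) (fromℕ-mono-≤ q≤K) ⟩
          fromℕ K * (D * e)      ∎)
          where
          d∣q : d ∣ q j
          d∣q = coprime-divisor (+ d) M (+ q j) (d-coprime-c+dm m) (ℤ∣.∣⇒∣ᵤ {+ d} (≡.subst (ℤ∣._∣_ (+ d)) (≡.sym Mq≡Kp)
            (ℤ∣.∣m⇒∣m*n (p j) (≡.subst (ℤ∣._∣_ (+ d)) (≡.sym (ℤₚ.pos-* d k)) (ℤ∣.∣m⇒∣m*n (+ k) ℤ∣.∣-refl)))))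
          -- By `Mq≡Kp`, `q j` divides `K` times `p j`; being prime to `p j`, it divides `K`.
          q≤K : q j ℕ.≤ K
          q≤K = ℕ∣.∣⇒≤ {{ℕ.>-nonZero 1≤K}} (coprime-divisor (+ q j) (p j) (+ K) (q-coprime-p j)
            (ℤ∣.∣⇒∣ᵤ {+ q j} (≡.subst (ℤ∣._∣_ (+ q j)) (≡.trans Mq≡Kp (ℤₚ.*-comm (+ K) (p j)))
              (ℤ∣.∣n⇒∣m*n M ℤ∣.∣-refl))))

      denominator⇒approximation : ∀ j → 1 ℕ.≤ j → d ∣ q j →
        ∃ λ k → 1 ℕ.≤ k × k ℕ.≤ q j × ∃ λ e → 0# < e × e ≤ E j ×
        signedFrac (fromℕ k * α - ρ) ≈ sgn (parity j) * e
      denominator⇒approximation j 1≤j (ℕ∣.divides r q≡rd) =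
        k , ℕ.s≤s ℕ.z≤n , n%ℕd<d i (q j) , e , 0<e , e≤E ,
        signedFrac-sgn (parity j) m x-se≈m 0<e (begin-strict
          e + e      ≤⟨ y≈x+d⇒x≤y (*-nonNeg (inj₁ (+-pos 0#<1# 0#<1#)) (x≤y⇒0≤y-x e≤E))
                          (solve 2 (λ e E → E :+ E := (e :+ e) :+ (con (+ 1) :+ con (+ 1)) :* (E :- e))
                                refl e (E j)) ⟩
          E j + E j  <⟨ 2E<1 1≤j ⟩
          1#         ∎)
        where
        instance
          q≢0 : NonZero (q j)
          q≢0 = ℕ.>-nonZero (q-pos j)
        u = proj₁ (bezout j)
        v = proj₁ (proj₂ (bezout j))
        up+vq≡1 : u ℤ.* p j ℤ.+ v ℤ.* + q j ≡ + 1
        up+vq≡1 = proj₂ (proj₂ (bezout j))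
        -- `u` inverts `p j` modulo `q j`, so `k` has to be congruent to u c r. Subtracting 1 before
        -- the division and adding it back afterwards places `k` in 1, ..., q_j, which excludes k =
        -- 0.
        i = u ℤ.* (c ℤ.* + r) ℤ.- + 1
        k = ℕ.suc (i %ℕ q j)
        w = i /ℕ q j
        -- Forced by `kp≡`: write k = u z - w Q with z = c r, then replace u P by 1 - v Q.
        m = ℤ.- (v ℤ.* (c ℤ.* + r) ℤ.+ w ℤ.* p j)
        kp≡ : + k ℤ.* p j ≡ c ℤ.* + r ℤ.+ + q j ℤ.* m
        kp≡ = ≡.trans (k≡ (+ (i %ℕ q j)) u w (c ℤ.* + r) (p j) (+ q j) (a≡a%ℕn+[a/ℕn]*n i (q j)))
          (≡.trans (unit u v w (c ℤ.* + r) (p j) (+ q j))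
            (≡.trans (≡.cong (λ y → c ℤ.* + r ℤ.* y ℤ.+ + q j ℤ.* m) up+vq≡1)
              (≡.cong (ℤ._+ + q j ℤ.* m) (ℤₚ.*-identityʳ (c ℤ.* + r)))))
          where
          k≡ : ∀ l u w z P Q → u ℤ.* z ℤ.- + 1 ≡ l ℤ.+ w ℤ.* Q →
               (+ 1 ℤ.+ l) ℤ.* P ≡ (u ℤ.* z ℤ.- w ℤ.* Q) ℤ.* P
          k≡ l u w z P Q eq = ≡.cong (ℤ._* P) (≡.trans (shift l w Q)
            (≡.trans (≡.cong (λ y → + 1 ℤ.+ y ℤ.- w ℤ.* Q) (≡.sym eq)) (unshift u w z Q)))
            where
            shift : ∀ l w Q → + 1 ℤ.+ l ≡ + 1 ℤ.+ (l ℤ.+ w ℤ.* Q) ℤ.- w ℤ.* Q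
            shift = ℤ-solve-∀
            unshift : ∀ u w z Q → + 1 ℤ.+ (u ℤ.* z ℤ.- + 1) ℤ.- w ℤ.* Q ≡ u ℤ.* z ℤ.- w ℤ.* Q
            unshift = ℤ-solve-∀
          unit : ∀ u v w z P Q → (u ℤ.* z ℤ.- w ℤ.* Q) ℤ.* P ≡
                 z ℤ.* (u ℤ.* P ℤ.+ v ℤ.* Q) ℤ.+ Q ℤ.* (ℤ.- (v ℤ.* z ℤ.+ w ℤ.* P))
          unit = ℤ-solve-∀
        D = fromℕ d
        Q = fromℕ (q j)
        R = fromℕ r
        s = sgn (parity j)
        0<Q : 0# < Q
        0<Q = fromℕ-pos (q-pos j)
        -- Since ρ = c r / q_j and k p_j = c r + q_j m, the difference kα - ρ - m equals k δ_j /
        -- q_j; `e` is its absolute value.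
        e = fromℕ k * E j * Q ⁻¹
        0<e : 0# < e
        0<e = *-pos (*-pos (fromℕ-pos {k} (ℕ.s≤s ℕ.z≤n)) (E-pos j)) (⁻¹-pos 0<Q)
        Qe≈ : Q * e ≈ fromℕ k * E j
        Qe≈ = modulo (fromℕ k * E j) (*-inverseʳ (λ Q≈0 → <.irrefl (sym Q≈0) 0<Q))
          (solve 3 (λ Q z I → Q :* (z :* I) := z :+ z :* (Q :* I :- con (+ 1))) refl Q (fromℕ k * E j) (Q ⁻¹))
        e≤E : e ≤ E j
        e≤E = *-cancelˡ-≤ 0<Q (begin
          Q * e          ≈⟨ Qe≈ ⟩
          fromℕ k * E j  ≤⟨ *-monoʳ-≤ (inj₁ (E-pos j)) (fromℕ-mono-≤ (n%ℕd<d i (q j))) ⟩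
          Q * E j        ∎)
        Q≈RD : Q ≈ R * D
        Q≈RD = trans (reflexive (≡.cong fromℕ q≡rd)) (fromℕ-* r d)
        kP≈ : fromℕ k * fromℤ (p j) ≈ fromℤ c * R + Q * fromℤ m
        kP≈ = begin-equality
          fromℕ k * fromℤ (p j)                    ≈⟨ fromℤ-* (+ k) (p j) ⟨
          fromℤ (+ k ℤ.* p j)                      ≡⟨ ≡.cong fromℤ kp≡ ⟩
          fromℤ (c ℤ.* + r ℤ.+ + q j ℤ.* m)        ≈⟨ fromℤ-+ (c ℤ.* + r) (+ q j ℤ.* m) ⟩
          fromℤ (c ℤ.* + r) + fromℤ (+ q j ℤ.* m)  ≈⟨ +-cong (fromℤ-* c (+ r)) (fromℤ-* (+ q j) m) ⟩
          fromℤ c * R + Q * fromℤ m                ∎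
        x-se≈m : (fromℕ k * α - ρ) - s * e ≈ fromℤ m
        x-se≈m = *-cancelˡ-≈ 0<Q (begin-equality
          Q * ((fromℕ k * α - ρ) - s * e)
            ≈⟨ solve 6 (λ Q k x r s e → Q :* ((k :* x :- r) :- s :* e) := (k :* (Q :* x) :- Q :* r) :- s :* (Q :* e))
                 refl Q (fromℕ k) α ρ s e ⟩
          (fromℕ k * (Q * α) - Q * ρ) - s * (Q * e)
            ≈⟨ +-cong (+-congˡ (-‿cong (trans (*-congʳ Q≈RD) (trans (*-assoc R D ρ) (*-congˡ dρ≈c))))) (-‿cong (*-congˡ Qe≈)) ⟩
          (fromℕ k * (Q * α) - R * fromℤ c) - s * (fromℕ k * E j)
            ≈⟨ modulo (fromℕ k) (δ≈ j) (solve 7 (λ k Qx R C s E P →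
                 (k :* Qx :- R :* C) :- s :* (k :* E) := (k :* P :- R :* C) :+ k :* ((Qx :- P) :- s :* E))
                 refl (fromℕ k) (Q * α) R (fromℤ c) s (E j) (fromℤ (p j))) ⟩
          fromℕ k * fromℤ (p j) - R * fromℤ c
            ≈⟨ modulo 1# kP≈ (solve 5 (λ kP R C Q m → kP :- R :* C := Q :* m :+
                 con (+ 1) :* (kP :- (C :* R :+ Q :* m))) refl (fromℕ k * fromℤ (p j)) R (fromℤ c) Q (fromℤ m)) ⟩
          Q * fromℤ m ∎)

      -- Comparison of the two smallness conditions

      module WithPower (β : ℝ) (1≤β : 1# ≤ β) (σ : Sign) where

        open Power β 1≤β

        -- The ε-forms of the two vanishing lower limits. The factor `sgn σ` turns the sign
        -- condition into positivity for both signs.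
        SmallApproximations SmallDenominators : Set
        SmallApproximations = ∀ ε → 0# < ε → ∃ λ k → 1 ℕ.≤ k ×
          0# < sgn σ * signedFrac (fromℕ k * α - ρ) × k ^ᴿ β * (sgn σ * signedFrac (fromℕ k * α - ρ)) < ε
        SmallDenominators = ∀ ε → 0# < ε → ∃ λ j → 1 ℕ.≤ j × parity j ≡ σ × d ∣ q j × q j ^ᴿ β * E j < ε

        approximations⇒denominators : SmallApproximations → SmallDenominators
        approximations⇒denominators small ε 0<ε
          -- Staying below `E 0` rules out j = 0; the further cap at 1 serves the smallness
          -- condition of `legendre`.
          with positive-lowerBound 0<ε (E-pos 0)
        ... | μ , 0<μ , μ≤ε , μ≤E₀ with positive-lowerBound 0<μ 0#<1#
        ...   | ν , 0<ν , ν≤μ , ν≤1 = conclude (small (ν * C ⁻¹) (*-pos 0<ν (⁻¹-pos 0<C)))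
          where
          D = fromℕ d
          0<D = fromℕ-pos 1≤d
          -- `C₁` bounds (d k)^β d e by a multiple of k^β e, and `C₂` comes from the product 4 (d
          -- k)(d e) in the condition of `legendre`. Dividing by their sum makes one choice of `k`
          -- serve both.
          C₁ = fromℕ d ^ B * D
          C₂ = fromℕ 4 * (D * D)
          C = C₁ + C₂
          0<C₁ : 0# < C₁
          0<C₁ = *-pos (^-pos B 0<D) 0<D
          0<C₂ : 0# < C₂
          0<C₂ = *-pos (fromℕ-pos {4} (ℕ.s≤s ℕ.z≤n)) (*-pos 0<D 0<D)
          0<C : 0# < C
          0<C = +-pos 0<C₁ 0<C₂
          conclude : (∃ λ k → 1 ℕ.≤ k × 0# < sgn σ * signedFrac (fromℕ k * α - ρ) ×
                       k ^ᴿ β * (sgn σ * signedFrac (fromℕ k * α - ρ)) < ν * C ⁻¹) →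
                     ∃ λ j → 1 ℕ.≤ j × parity j ≡ σ × d ∣ q j × q j ^ᴿ β * E j < ε
          conclude (k , 1≤k , 0<e , kᵝe<) = finish
            (approximation⇒denominator σ k 1≤k 0<e (sym (sgn-sgn-* σ _)) (begin-strict
              fromℕ 4 * (fromℕ (d ℕ.* k) * (D * e))   ≈⟨ *-congˡ (*-congʳ (fromℕ-* d k)) ⟩
              fromℕ 4 * (D * fromℕ k * (D * e))
                  ≈⟨ solve 4 (λ f D k e → f :* (D :* k :* (D :* e)) := (f :* (D :* D)) :* (k :* e)) refl (fromℕ 4) D (fromℕ k) e ⟩
              C₂ * (fromℕ k * e)
                  ≤⟨ *-monoˡ-≤ (inj₁ 0<C₂) (*-monoʳ-≤ (inj₁ 0<e) (k≤k^ᴿβ 1≤k)) ⟩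
              C₂ * w                                  <⟨ y≈x+d⇒x<y (*-pos 0<C₁ 0<w)
                  (solve 3 (λ a b w → (a :+ b) :* w := b :* w :+ a :* w) refl C₁ C₂ w) ⟩
              C * w                                   <⟨ Cw<ν ⟩
              ν                                       ≤⟨ ν≤1 ⟩
              1#                                      ∎))
            where
            e = sgn σ * signedFrac (fromℕ k * α - ρ)
            w = k ^ᴿ β * e
            0<w : 0# < w
            0<w = *-pos (^ᴿ-pos 1≤k) 0<e
            Cw<ν : C * w < ν
            Cw<ν = begin-strict
              C * w             <⟨ *-monoˡ-< 0<C kᵝe< ⟩
              C * (ν * C ⁻¹)    ≈⟨ modulo ν (*-inverseʳ (λ C≈0 → <.irrefl (sym C≈0) 0<C))
                                     (solve 3 (λ C n I → C :* (n :* I) := n :+ n :* (C :* I :- con (+ 1)))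
                                           refl C ν (C ⁻¹)) ⟩
              ν                 ∎
            finish : (∃ λ j → parity j ≡ σ × d ∣ q j × q j ℕ.≤ d ℕ.* k × E j ≤ D * e) →
                     ∃ λ j → 1 ℕ.≤ j × parity j ≡ σ × d ∣ q j × q j ^ᴿ β * E j < ε
            finish (j , par , d∣q , q≤dk , E≤De) = j , 1≤j j qᵝE<μ , par , d∣q ,
              (begin-strict q j ^ᴿ β * E j <⟨ qᵝE<μ ⟩ μ ≤⟨ μ≤ε ⟩ ε ∎)
              where
              qᵝE<μ : q j ^ᴿ β * E j < μ
              qᵝE<μ = begin-strict
                q j ^ᴿ β * E j                   ≤⟨ *-mono-≤ (inj₁ (E-pos j)) (inj₁ (^ᴿ-pos (ℕₚ.*-mono-≤ 1≤d 1≤k)))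
                                                      (^ᴿ-mono-≤ (q-pos j) q≤dk) E≤De ⟩
                (d ℕ.* k) ^ᴿ β * (D * e)
                    ≤⟨ *-monoʳ-≤ (inj₁ (*-pos 0<D 0<e)) (^ᴿ-submultiplicative 1≤d 1≤k) ⟩
                D ^ B * k ^ᴿ β * (D * e)
                    ≈⟨ solve 4 (λ b k D e → b :* k :* (D :* e) := (b :* D) :* (k :* e)) refl (D ^ B) (k ^ᴿ β) D e ⟩
                C₁ * w                           <⟨ y≈x+d⇒x<y (*-pos 0<C₂ 0<w)
                    (solve 3 (λ a b w → (a :+ b) :* w := a :* w :+ b :* w) refl C₁ C₂ w) ⟩
                C * w                            <⟨ Cw<ν ⟩
                ν                                ≤⟨ ν≤μ ⟩
                μ                                ∎
              -- At j = 0 the value is `1 ^ᴿ β * E 0`, which is at least `E 0` and so at least μ.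
              1≤j : ∀ j → q j ^ᴿ β * E j < μ → 1 ℕ.≤ j
              1≤j (ℕ.suc _) _ = ℕ.s≤s ℕ.z≤n
              1≤j ℕ.zero    E₀< = ⊥-elim (<⇒≱ E₀< (begin
                μ             ≤⟨ μ≤E₀ ⟩
                E 0           ≈⟨ *-identityˡ (E 0) ⟨
                1# * E 0      ≤⟨ *-monoʳ-≤ (inj₁ (E-pos 0)) (≤.trans (1≤fromℕ {1} ℕₚ.≤-refl) (k≤k^ᴿβ ℕₚ.≤-refl)) ⟩
                1 ^ᴿ β * E 0  ∎))

        -- Here no constant is lost: `k ≤ q j` and `e ≤ E j`, so the same ε serves.
        denominators⇒approximations : SmallDenominators → SmallApproximations
        denominators⇒approximations small ε 0<ε = conclude (small ε 0<ε)
          where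
          Goal = ∃ λ k → 1 ℕ.≤ k × 0# < sgn σ * signedFrac (fromℕ k * α - ρ) ×
                   k ^ᴿ β * (sgn σ * signedFrac (fromℕ k * α - ρ)) < ε
          conclude : (∃ λ j → 1 ℕ.≤ j × parity j ≡ σ × d ∣ q j × q j ^ᴿ β * E j < ε) → Goal
          conclude (j , 1≤j , par , d∣q , qᵝE<ε) = finish (denominator⇒approximation j 1≤j d∣q)
            where
            finish : (∃ λ k → 1 ℕ.≤ k × k ℕ.≤ q j × ∃ λ e → 0# < e × e ≤ E j ×
                       signedFrac (fromℕ k * α - ρ) ≈ sgn (parity j) * e) → Goal
            finish (k , 1≤k , k≤q , e , 0<e , e≤E , s≈) =
              k , 1≤k , <.<-respʳ-≈ (sym σs≈e) 0<e , (begin-strict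
                k ^ᴿ β * (sgn σ * signedFrac (fromℕ k * α - ρ))  ≈⟨ *-congˡ σs≈e ⟩
                k ^ᴿ β * e      ≤⟨ *-mono-≤ (inj₁ 0<e) (inj₁ (^ᴿ-pos (q-pos j))) (^ᴿ-mono-≤ 1≤k k≤q) e≤E ⟩
                q j ^ᴿ β * E j  <⟨ qᵝE<ε ⟩
                ε               ∎)
              where
              σs≈e : sgn σ * signedFrac (fromℕ k * α - ρ) ≈ e
              σs≈e = trans (*-congˡ (trans s≈ (*-congʳ (reflexive (≡.cong sgn par))))) (sgn-sgn-* σ e)

        -- R and h stand for the sign condition and the value in the two lower limits
        -- with sign σ; index enumerates the positive integers of parity σ.
        limInf-equivalence :
          (R : ℝ → Set) (h : ℝ → ℝ → ℝ) (index : ℕ → ℕ) →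
          (∀ y → R y ⇔ 0# < sgn σ * y) → (∀ x y → h x y ≈ x * (sgn σ * y)) →
          (∀ n → 1 ℕ.≤ n → 1 ℕ.≤ index n × parity (index n) ≡ σ) →
          (∀ j → 1 ℕ.≤ j → parity j ≡ σ → ∃ λ n → 1 ℕ.≤ n × j ≡ index n) →
          limInf (λ k → 1 ℕ.≤ k × R (signedFrac (fromℕ k * α - ρ)))
                 (λ k → h (k ^ᴿ β) (signedFrac (fromℕ k * α - ρ))) ≈± [ 0# ] ⇔
          limInf (λ n → 1 ℕ.≤ n × d ∣ q (index n))
                 (λ n → h (q (index n) ^ᴿ β) (signedFrac (fromℕ (q (index n)) * α))) ≈± [ 0# ]
        limInf-equivalence R h index R⇔ h≈ index-valid index-onto = mk⇔
          (λ μ≈0 → small⇒limInf≈0 v-pos (denominators⇒v (approximations⇒denominators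
            (u⇒approximations (limInf≈0⇒small u-pos μ≈0)))))
          (λ λ≈0 → small⇒limInf≈0 u-pos (approximations⇒u (denominators⇒approximations
            (v⇒denominators (limInf≈0⇒small v-pos λ≈0)))))
          where
          S = λ k → 1 ℕ.≤ k × R (signedFrac (fromℕ k * α - ρ))
          u = λ k → h (k ^ᴿ β) (signedFrac (fromℕ k * α - ρ))
          T = λ n → 1 ℕ.≤ n × d ∣ q (index n)
          v = λ n → h (q (index n) ^ᴿ β) (signedFrac (fromℕ (q (index n)) * α))
          u-pos : ∀ k → S k → 0# < u k
          u-pos k (1≤k , Rs) = <.<-respʳ-≈ (sym (h≈ _ _)) (*-pos (^ᴿ-pos 1≤k) (Equivalence.to (R⇔ _) Rs))
          v≈ : ∀ n → 1 ℕ.≤ n → v n ≈ q (index n) ^ᴿ β * E (index n)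
          v≈ n 1≤n with index-valid n 1≤n
          ... | 1≤i , par = trans (h≈ _ _) (*-congˡ (trans (*-congˡ (trans (signedFrac-qα 1≤i)
                  (*-congʳ (reflexive (≡.cong sgn par))))) (sgn-sgn-* σ (E (index n)))))
          v-pos : ∀ n → T n → 0# < v n
          v-pos n (1≤n , _) = <.<-respʳ-≈ (sym (v≈ n 1≤n)) (*-pos (^ᴿ-pos (q-pos (index n))) (E-pos (index n)))
          u⇒approximations : (∀ ε → 0# < ε → ∃ λ k → S k × u k < ε) → SmallApproximations
          u⇒approximations small ε 0<ε with small ε 0<ε
          ... | k , (1≤k , Rs) , uk<ε = k , 1≤k , Equivalence.to (R⇔ _) Rs , <.<-respˡ-≈ (h≈ _ _) uk<ε
          approximations⇒u : SmallApproximations → ∀ ε → 0# < ε → ∃ λ k → S k × u k < ε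
          approximations⇒u small ε 0<ε with small ε 0<ε
          ... | k , 1≤k , 0<s , <ε = k , (1≤k , Equivalence.from (R⇔ _) 0<s) , <.<-respˡ-≈ (sym (h≈ _ _)) <ε
          v⇒denominators : (∀ ε → 0# < ε → ∃ λ n → T n × v n < ε) → SmallDenominators
          v⇒denominators small ε 0<ε with small ε 0<ε
          ... | n , (1≤n , d∣q) , vn<ε = index n , proj₁ (index-valid n 1≤n) , proj₂ (index-valid n 1≤n) ,
                  d∣q , <.<-respˡ-≈ (v≈ n 1≤n) vn<ε
          denominators⇒v : SmallDenominators → ∀ ε → 0# < ε → ∃ λ n → T n × v n < ε
          denominators⇒v small ε 0<ε with small ε 0<ε
          ... | j , 1≤j , par , d∣q , <ε with index-onto j 1≤j par
          ...   | n , 1≤n , ≡.refl = n , (1≤n , d∣q) , <.<-respˡ-≈ (sym (v≈ n 1≤n)) <ε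

theorem1p2 : (em : ExcludedMiddle 0ℓ) (𝓡 : CompleteOrderedField) →
    let open Analysis em 𝓡 in
    (α β : ℝ) → 1# ≤ β → Irrational α →
    (p : ℤ) (q : ℕ) .{{_ : NonZero q}} → gcd p (+ q) ≡ + 1 →
    let qₙ = denominator α in
    (μ₊ α β (p /ᴿ q) ≈± [ 0# ] ⇔
    limInf (λ n → 1 ℕ.≤ n × q ∣ qₙ (2 ℕ.* n))
    (λ n → qₙ (2 ℕ.* n) ^ᴿ β * signedFrac (fromℕ (qₙ (2 ℕ.* n)) * α))
    ≈± [ 0# ])
    ×
    (μ₋ α β (p /ᴿ q) ≈± [ 0# ] ⇔
    limInf (λ n → 1 ℕ.≤ n × q ∣ qₙ (2 ℕ.* n ∸ 1))
    (λ n → - (qₙ (2 ℕ.* n ∸ 1) ^ᴿ β * signedFrac (fromℕ (qₙ (2 ℕ.* n ∸ 1)) * α)))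
    ≈± [ 0# ])
theorem1p2 em 𝓡 α β 1≤β α-irrational p q gcd≡1 =
  limInf-equivalence₊ (0# <_) _*_ (2 ℕ.*_)
    (λ y → mk⇔ (<.<-respʳ-≈ (sym (*-identityˡ y))) (<.<-respʳ-≈ (*-identityˡ y)))
    (λ x y → *-congˡ (sym (*-identityˡ y)))
    even-index-valid even-index-onto ,
  limInf-equivalence₋ (_< 0#) (λ x y → - (x * y)) (λ n → 2 ℕ.* n ∸ 1)
    <0⇔0<-1* -*≈*-1*
    odd-index-valid odd-index-onto
  where
  open Analysis em 𝓡
  open Reals em 𝓡
  open ContinuedFraction.Rational α α-irrational p q (gcd≡1⇒coprime (ℤₚ.+-injective gcd≡1))
  open WithPower β 1≤β Sign.+ renaming (limInf-equivalence to limInf-equivalence₊)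
  open WithPower β 1≤β Sign.- renaming (limInf-equivalence to limInf-equivalence₋)
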